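{- Let $G$ be a cograph minimal $(\infty,2)$-polar obstruction. Then: (1) $G$ is connected if and only if $\overline{G} \cong P_3 + H$, where $H$ is isomorphic to $K_1 \oplus C_4$, $\overline{2P_3}$, $K_2 \oplus 2K_2$, or $K_1 \oplus (K_2 + P_3)$; (2) $G$ is disconnected and has no isolated vertices if and only if $G$ is isomorphic to $P_3 + C_4$, $P_3 + (K_1 \oplus 2K_2)$, or $2P_3 + K_2$; (3) $G$ has exactly $4$ connected components if and only if $G$ is isomorphic to $3K_1 + (K_1 \oplus C_4)$ or to $pK_1 + (3-p)K_2 + K_{p,p}$ for some $p \in \{1,2,3\}$; (4) $G$ has exactly $3$ connected components and at least one isolated vertex if and only if $G$ is isomorphic to $2K_1 + \overline{2P_3}$, $2K_1 + (K_1 \oplus (P_3+K_2))$, $2K_1 + (K_2 \oplus 2K_2)$, $2K_1 + (K_1 \oplus (C_4 + K_1))$, $2K_1 + (K_1 \oplus \overline{P_3 + K_2})$, $2K_1 + (\overline{K_2} \oplus (P_3 + K_1))$, or $pK_1 + (2-p)K_2 + (2K_1 \oplus (K_2 + pK_1))$ for some $p \in \{1,2\}$; (5) $G$ has exactly $2$ connected components and one isolated vertex if and only if $G$ is isomorphic to $K_1 + (K_1 \oplus (K_1 + 2K_2))$, $K_1 + (K_1 \oplus (2K_1 + C_4))$, $K_1 + (K_1 \oplus 2P_3)$, or $K_1 + (K_1 \oplus (K_1 + \overline{K_2 + P_3}))$. In conclusion, a graph $G$ is a cograph minimal $(\infty,2)$-polar obstruction if and only if it is isomorphic to one of the $23$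 cographs listed above.
   Context: All graphs are finite and simple. A cograph is a graph with no induced subgraph isomorphic to $P_4$. $G+H$ denotes disjoint union, $G \oplus H$ the join (disjoint union plus all edges between $G$ and $H$), $nG$ the disjoint union of $n$ copies of $G$ ($0G$ is the empty graph), $\overline{G}$ the complement of $G$; $K_n$, $P_n$, $C_n$ are the complete graph, path and cycle on $n$ vertices and $K_{p,q}$ the complete bipartite graph. A cluster is a disjoint union of complete graphs. For $s,k \in \mathbb{Z}_{\ge 0}\cup\{\infty\}$, an $(s,k)$-polar partition of $G$ is a partition $(A,B)$ of $V(G)$ (parts may be empty) such that $G[A]$ is a complete multipartite graph with at most $s$ parts and $G[B]$ is a cluster with at most $k$ components; $\infty$ means unbounded. $G$ is $(s,k)$-polar if it has such a partition. A cograph minimal $(s,k)$-polar obstruction is a cograph that is not $(s,k)$-polar but all of whose proper induced subgraphs are $(s,k)$-polar. -}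

module Defs where

open import Data.Nat using (ℕ; zero; suc; _<_; _≤_; _∸_)
open import Data.Nat.Base using (_≡ᵇ_)
import Data.Nat as N
open import Data.Fin using (Fin; toℕ; splitAt; _≟_)
open import Data.Bool using (Bool; true; false; not; _∧_; _∨_)
open import Data.Bool.Properties using (∨-comm)
open import Data.Sum using (_⊎_; inj₁; inj₂)
open import Data.Product using (Σ; ∃; _×_; _,_)
open import Data.Unit using (⊤)
open import Data.Empty using (⊥; ⊥-elim)
open import Relation.Nullary using (¬_; yes; no)
open import Relation.Nullary.Decidable using (⌊_⌋)
open import Relation.Binary.PropositionalEquality using (_≡_; _≢_; refl; sym; cong₂)
open import Function.Bundles using (_↔_; _⇔_; Inverse)
open import Function.Definitions using (Injective)

record Graph : Set where
  field
    n      : ℕ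
    adj    : Fin n → Fin n → Bool
    adj-sym : ∀ i j → adj i j ≡ adj j i
    adj-irrefl : ∀ i → adj i i ≡ false
open Graph public

eqᵇ : ∀ {m} → Fin m → Fin m → Bool
eqᵇ i j = ⌊ i ≟ j ⌋

eqᵇ-sym : ∀ {m} (i j : Fin m) → eqᵇ i j ≡ eqᵇ j i
eqᵇ-sym i j with i ≟ j | j ≟ i
... | yes _ | yes _ = refl
... | no _  | no _  = refl
... | yes p | no q  = ⊥-elim (q (sym p))
... | no q  | yes p = ⊥-elim (q (sym p))

eqᵇ-refl : ∀ {m} (i : Fin m) → eqᵇ i i ≡ true
eqᵇ-refl i with i ≟ i
... | yes _ = refl
... | no q  = ⊥-elim (q refl)

mkGraph : (m : ℕ) → (Fin m → Fin m → Bool) → Graph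
mkGraph m r = record
  { n = m
  ; adj = λ i j → not (eqᵇ i j) ∧ (r i j ∨ r j i)
  ; adj-sym = λ i j → cong₂ (λ a b → not a ∧ b) (eqᵇ-sym i j) (∨-comm (r i j) (r j i))
  ; adj-irrefl = λ i → irr i
  }
  where
  irr : ∀ i → not (eqᵇ i i) ∧ (r i i ∨ r i i) ≡ false
  irr i rewrite eqᵇ-refl i = refl

K : ℕ → Graph
K m = mkGraph m (λ _ _ → true)

K₁ K₂ : Graph
K₁ = K 1
K₂ = K 2

P : ℕ → Graph
P m = mkGraph m (λ i j → toℕ j ≡ᵇ suc (toℕ i))

-- cycle C_m (m ≥ 3 intended) : path plus edge {0, m-1}
C : ℕ → Graph
C m = mkGraph m (λ i j → (toℕ j ≡ᵇ suc (toℕ i)) ∨ ((toℕ i ≡ᵇ 0) ∧ (toℕ j ≡ᵇ (m ∸ 1))))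

co : Graph → Graph
co G = mkGraph (n G) (λ i j → not (adj G i j))

block : ∀ a b → (Fin a → Fin a → Bool) → (Fin b → Fin b → Bool) → Bool
        → Fin (a N.+ b) → Fin (a N.+ b) → Bool
block a b r s x i j with splitAt a i | splitAt a j
... | inj₁ u | inj₁ v = r u v
... | inj₂ u | inj₂ v = s u v
... | inj₁ _ | inj₂ _ = x
... | inj₂ _ | inj₁ _ = x

infixl 6 _+ᴳ_
infixl 7 _⊕ᴳ_
infixr 8 _·_

_+ᴳ_ : Graph → Graph → Graph
G +ᴳ H = mkGraph (n G N.+ n H) (block (n G) (n H) (adj G) (adj H) false)

_⊕ᴳ_ : Graph → Graph → Graph
G ⊕ᴳ H = mkGraph (n G N.+ n H) (block (n G) (n H) (adj G) (adj H) true)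

∅ᴳ : Graph
∅ᴳ = mkGraph 0 (λ _ _ → false)

_·_ : ℕ → Graph → Graph
zero  · G = ∅ᴳ
suc k · G = G +ᴳ (k · G)

Kbip : ℕ → ℕ → Graph
Kbip p q = (p · K₁) ⊕ᴳ (q · K₁)

_≅_ : Graph → Graph → Set
G ≅ H = Σ (Fin (n G) ↔ Fin (n H)) λ f →
          ∀ i j → adj G i j ≡ adj H (Inverse.to f i) (Inverse.to f j)

-- subgraph induced by the image of f (an injective f gives an induced subgraph)
induced : (G : Graph) {m : ℕ} → (Fin m → Fin (n G)) → Graph
induced G {m} f = record
  { n = m
  ; adj = λ i j → adj G (f i) (f j)
  ; adj-sym = λ i j → adj-sym G (f i) (f j)
  ; adj-irrefl = λ i → adj-irrefl G (f i)
  }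

Cograph : Graph → Set
Cograph G = ¬ (Σ (Fin 4 → Fin (n G)) λ f →
                 Injective _≡_ _≡_ f × (induced G f ≅ P 4))

data ℕ∞ : Set where
  fin : ℕ → ℕ∞
  ∞   : ℕ∞

_<∞_ : ℕ → ℕ∞ → Set
x <∞ fin s = x < s
x <∞ ∞     = ⊤

-- G[A] (A = {u | inA u}) is complete multipartite with at most s parts:
-- part labels c, vertices of A adjacent iff in different parts.
CompleteMultipartiteOn : (G : Graph) → (Fin (n G) → Set) → ℕ∞ → Set
CompleteMultipartiteOn G inA s =
  Σ (Fin (n G) → ℕ) λ c →
    (∀ u → inA u → c u <∞ s) ×
    (∀ u v → inA u → inA v → (adj G u v ≡ true ⇔ c u ≢ c v))

-- G[B] is a cluster with at most k components (component labels c,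
-- distinct vertices of B adjacent iff same component).
ClusterOn : (G : Graph) → (Fin (n G) → Set) → ℕ∞ → Set
ClusterOn G inB k =
  Σ (Fin (n G) → ℕ) λ c →
    (∀ u → inB u → c u <∞ k) ×
    (∀ u v → inB u → inB v → (adj G u v ≡ true ⇔ (c u ≡ c v × u ≢ v)))

Polar : ℕ∞ → ℕ∞ → Graph → Set
Polar s k G = Σ (Fin (n G) → Bool) λ side →
  CompleteMultipartiteOn G (λ u → side u ≡ true) s ×
  ClusterOn G (λ u → side u ≡ false) k

MinimalPolarObstruction : ℕ∞ → ℕ∞ → Graph → Set
MinimalPolarObstruction s k G =
  ¬ Polar s k G ×
  (∀ (m : ℕ) (f : Fin m → Fin (n G)) → Injective _≡_ _≡_ f → m < n G →
     Polar s k (induced G f))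

CographMinObs : ℕ∞ → ℕ∞ → Graph → Set
CographMinObs s k G = Cograph G × MinimalPolarObstruction s k G

data Reach (G : Graph) : Fin (n G) → Fin (n G) → Set where
  here : ∀ {u} → Reach G u u
  step : ∀ {u v w} → adj G u v ≡ true → Reach G v w → Reach G u w

Components : Graph → ℕ → Set
Components G c =
  Σ (Fin (n G) → Fin c) λ κ →
    (∀ k → ∃ λ u → κ u ≡ k) ×
    (∀ u v → (κ u ≡ κ v ⇔ Reach G u v))

Connected : Graph → Set
Connected G = Components G 1

Isolated : (G : Graph) → Fin (n G) → Set
Isolated G v = ∀ u → adj G v u ≡ false

HasIsolated : Graph → Set
HasIsolated G = ∃ λ v → Isolated G v

ExactlyOneIsolated : Graph → Set
ExactlyOneIsolated G = ∃ λ v → Isolated G v × (∀ w → Isolated G w → w ≡ v)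

P₃ C₄ : Graph
P₃ = P 3
C₄ = C 4

FamH : Graph → Set
FamH H = (H ≅ (K₁ ⊕ᴳ C₄)) ⊎ (H ≅ co (2 · P₃)) ⊎ (H ≅ (K₂ ⊕ᴳ 2 · K₂))
         ⊎ (H ≅ (K₁ ⊕ᴳ (K₂ +ᴳ P₃)))

Fam2 : Graph → Set
Fam2 G = (G ≅ (P₃ +ᴳ C₄)) ⊎ (G ≅ (P₃ +ᴳ (K₁ ⊕ᴳ 2 · K₂))) ⊎ (G ≅ (2 · P₃ +ᴳ K₂))

Fam3 : Graph → Set
Fam3 G = (G ≅ (3 · K₁ +ᴳ (K₁ ⊕ᴳ C₄)))
         ⊎ (Σ ℕ λ p → 1 ≤ p × p ≤ 3 × (G ≅ (p · K₁ +ᴳ (3 ∸ p) · K₂ +ᴳ Kbip p p)))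

Fam4 : Graph → Set
Fam4 G = (G ≅ (2 · K₁ +ᴳ co (2 · P₃)))
       ⊎ (G ≅ (2 · K₁ +ᴳ (K₁ ⊕ᴳ (P₃ +ᴳ K₂))))
       ⊎ (G ≅ (2 · K₁ +ᴳ (K₂ ⊕ᴳ 2 · K₂)))
       ⊎ (G ≅ (2 · K₁ +ᴳ (K₁ ⊕ᴳ (C₄ +ᴳ K₁))))
       ⊎ (G ≅ (2 · K₁ +ᴳ (K₁ ⊕ᴳ co (P₃ +ᴳ K₂))))
       ⊎ (G ≅ (2 · K₁ +ᴳ (co K₂ ⊕ᴳ (P₃ +ᴳ K₁))))
       ⊎ (Σ ℕ λ p → 1 ≤ p × p ≤ 2 ×
            (G ≅ (p · K₁ +ᴳ (2 ∸ p) · K₂ +ᴳ (2 · K₁ ⊕ᴳ (K₂ +ᴳ p · K₁)))))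

Fam5 : Graph → Set
Fam5 G = (G ≅ (K₁ +ᴳ (K₁ ⊕ᴳ (K₁ +ᴳ 2 · K₂))))
       ⊎ (G ≅ (K₁ +ᴳ (K₁ ⊕ᴳ (2 · K₁ +ᴳ C₄))))
       ⊎ (G ≅ (K₁ +ᴳ (K₁ ⊕ᴳ 2 · P₃)))
       ⊎ (G ≅ (K₁ +ᴳ (K₁ ⊕ᴳ (K₁ +ᴳ co (K₂ +ᴳ P₃)))))

Fam1 : Graph → Set
Fam1 G = Σ Graph λ H → FamH H × (G ≅ co (P₃ +ᴳ H))

Listed : Graph → Set
Listed G = Fam1 G ⊎ Fam2 G ⊎ Fam3 G ⊎ Fam4 G ⊎ Fam5 G

{-# OPTIONS --safe #-}
module Submission where

-- A cograph is built from single vertices by disjoint union and join, and so is described by a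
-- cotree. For s ∈ {0, 1, ∞} let f_s(G) be the least k ≤ 2 such that G is (s,k)-polar, and 3 if
-- there is none. A polar partition of G + H or G ⊕ H splits into polar partitions of G and H, so
-- the state (f_0, f_1, f_∞) of a union or join depends only on the states of the two parts, and
-- replacing a part by one of its induced subgraphs with the same state does not change the state
-- of the whole. Discarding vertices as long as the state is kept, one reaches only 71 cographs:
-- 48 that are (∞,2)-polar (the empty graph included) and the 23 listed ones. This is proved by
-- induction on cotrees, by checking that the sums and joins of two of the 48 polar ones shrink back
-- into the list. Hence every cograph that is not (∞,2)-polar contains one of the 23 as an induced
-- subgraph.

open import Defs hiding (here; step)
open import Data.Bool using (Bool; true; false; not; _∨_; if_then_else_)
open import Data.Bool.Properties using (not-involutive; ¬-not; not-¬; ∨-idem) renaming (_≟_ to _≟ᵇ_)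
open import Data.Empty using (⊥; ⊥-elim)
open import Data.Fin using (Fin; zero; suc; splitAt; punchIn; punchOut; _↑ˡ_; _↑ʳ_)
  renaming (_≟_ to _≟ᶠ_; join to joinᶠ)
open import Data.Fin.Patterns using (0F; 1F; 2F; 3F)
import Data.Fin.Properties as Finₚ
open import Data.List using (List; []; _∷_; _++_; map)
open import Data.List.Membership.Propositional using (_∈_; find)
import Data.List.Membership.DecPropositional as DecMembership
open import Data.List.Relation.Unary.All as All using (All)
open import Data.List.Relation.Unary.Any as Any using (Any; here; there)
open import Data.List.Relation.Unary.Any.Properties using (map⁺; map⁻; ++⁺ˡ; ++⁺ʳ; ++⁻)
open import Data.Maybe using (Maybe; just; nothing)
open import Data.Maybe.Properties using (just-injective)
open import Data.Nat using (ℕ; zero; suc; _+_; _*_; _∸_; _≤_; _<_; _⊓_; z≤n; s≤s; _≤?_)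
import Data.Nat.Properties as ℕₚ
open import Data.Product using (Σ; ∃; ∃₂; _×_; _,_; proj₁; proj₂)
open import Data.Product.Properties using (≡-dec)
open import Data.Sum as Sum using (_⊎_; inj₁; inj₂; [_,_]; map₂)
open import Data.Sum.Properties using (inj₁-injective; inj₂-injective)
open import Data.Unit using (⊤; tt)
open import Function using (_∘_; id; const; Injective)
open import Function.Bundles using (_⇔_; mk⇔; mk↔ₛ′; Equivalence; Inverse)
open import Function.Properties.Equivalence using () renaming (trans to ⇔-trans)
open import Relation.Binary.Construct.Closure.ReflexiveTransitive using (Star; ε; _◅_; gmap)
open import Relation.Binary.PropositionalEquality
  using (_≡_; _≢_; refl; sym; trans; cong; cong₂; subst; subst₂)
open import Relation.Nullary using (¬_; Dec; yes; no)
open import Relation.Nullary.Decidable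
  using (does; dec-true; dec-false; map′; ¬?; _×-dec_; _⊎-dec_; _→-dec_)

open Equivalence using () renaming (to to ⇒; from to ⇐)

-- The bounds 0, 1 and ∞ are closed under splitting, which is why three numbers suffice. In a
-- disjoint union, a complete multipartite side that meets both parts is edgeless, hence a single
-- independent set. In a join its classes do not mix, so a single class lies in one part, while an
-- unbounded number splits into two unbounded ones. At most two cliques likewise either lie in one
-- part of a union or split as 1 + 1. More classes never hurt, so f_∞ ≤ f_1 ≤ f_0, and a cograph
-- that is not (∞,2)-polar has state (3, 3, 3). For such a cograph, keeping the state means no more
-- than staying non-polar, so greedy deletion ends at a minimal obstruction. The proof itself relies
-- on evaluation here: that the shrunken tree embeds is shown in general, while that it is listed,
-- or polar with the old state, is decided case by case.

from-does : ∀ {A : Set} (a? : Dec A) → does a? ≡ true → A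
from-does (yes a) _ = a

by-cases : ∀ {A B : Set} → Dec A → (A → B) → (¬ A → B) → B
by-cases (yes a) f g = f a
by-cases (no ¬a) f g = g ¬a

-- Induced subgraphs and isomorphisms

infix 4 _↪_ _≃_

-- Relations on arbitrary types let graphs on `Fin n`, cotrees and one-vertex extensions be compared
-- without renumbering vertices.
record _↪_ {V W : Set} (R : V → V → Bool) (S : W → W → Bool) : Set where
  field
    to        : V → W
    injective : ∀ {x y} → to x ≡ to y → x ≡ y
    preserves : ∀ x y → R x y ≡ S (to x) (to y)

open _↪_

record _≃_ {V W : Set} (R : V → V → Bool) (S : W → W → Bool) : Set where
  field
    embedding  : R ↪ S
    surjective : ∀ y → ∃ λ x → to embedding x ≡ y

  from : W → V
  from = proj₁ ∘ surjective

  to∘from : ∀ y → to embedding (from y) ≡ y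
  to∘from = proj₂ ∘ surjective

  from∘to : ∀ x → from (to embedding x) ≡ x
  from∘to x = injective embedding (to∘from (to embedding x))

open _≃_

module _ {U V W : Set} {R : U → U → Bool} {S : V → V → Bool} {T : W → W → Bool} where

  ↪-trans : R ↪ S → S ↪ T → R ↪ T
  ↪-trans f g = record
    { to        = to g ∘ to f
    ; injective = injective f ∘ injective g
    ; preserves = λ x y → trans (preserves f x y) (preserves g _ _)
    }

  ≃-trans : R ≃ S → S ≃ T → R ≃ T
  ≃-trans f g = record
    { embedding  = ↪-trans (embedding f) (embedding g)
    ; surjective = λ z → from f (from g z) ,
        trans (cong (to (embedding g)) (to∘from f (from g z))) (to∘from g z)
    }

≃-refl : ∀ {V : Set} {R : V → V → Bool} → R ≃ R
≃-refl = record
  { embedding  = record { to = id ; injective = id ; preserves = λ _ _ → refl }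
  ; surjective = λ y → y , refl
  }

≃-sym : ∀ {V W : Set} {R : V → V → Bool} {S : W → W → Bool} → R ≃ S → S ≃ R
≃-sym {S = S} f = record
  { embedding = record
    { to        = from f
    ; injective = λ {x} {y} e →
        trans (sym (to∘from f x)) (trans (cong (to (embedding f)) e) (to∘from f y))
    ; preserves = λ x y → sym (trans (preserves (embedding f) _ _)
        (cong₂ S (to∘from f x) (to∘from f y)))
    }
  ; surjective = λ x → to (embedding f) x , from∘to f x
  }

-- Cotrees

infixr 6 _⊞_
infixr 7 _⊠_

-- node false is disjoint union and node true is join; ∅ makes cotrees closed under vertex deletion.
data Cotree : Set where
  ∅ ●  : Cotree
  node : Bool → Cotree → Cotree → Cotree

pattern _⊞_ l r = node false l r
pattern _⊠_ l r = node true l r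

_≟ᵗ_ : (s t : Cotree) → Dec (s ≡ t)
∅ ≟ᵗ ∅ = yes refl
∅ ≟ᵗ ● = no λ ()
∅ ≟ᵗ node _ _ _ = no λ ()
● ≟ᵗ ∅ = no λ ()
● ≟ᵗ ● = yes refl
● ≟ᵗ node _ _ _ = no λ ()
node _ _ _ ≟ᵗ ∅ = no λ ()
node _ _ _ ≟ᵗ ● = no λ ()
node b l r ≟ᵗ node c m s =
  map′ (λ { (refl , refl , refl) → refl }) (λ { refl → refl , refl , refl })
    (b ≟ᵇ c ×-dec l ≟ᵗ m ×-dec r ≟ᵗ s)

Vertex : Cotree → Set
Vertex ∅ = ⊥
Vertex ● = ⊤
Vertex (node _ l r) = Vertex l ⊎ Vertex r

edge : ∀ t → Vertex t → Vertex t → Bool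
edge ● _ _ = false
edge (node _ l _) (inj₁ x) (inj₁ y) = edge l x y
edge (node _ _ r) (inj₂ x) (inj₂ y) = edge r x y
edge (node b _ _) (inj₁ _) (inj₂ _) = b
edge (node b _ _) (inj₂ _) (inj₁ _) = b

edge-sym : ∀ t x y → edge t x y ≡ edge t y x
edge-sym ● _ _ = refl
edge-sym (node _ l _) (inj₁ x) (inj₁ y) = edge-sym l x y
edge-sym (node _ _ r) (inj₂ x) (inj₂ y) = edge-sym r x y
edge-sym (node _ _ _) (inj₁ _) (inj₂ _) = refl
edge-sym (node _ _ _) (inj₂ _) (inj₁ _) = refl

edge-irrefl : ∀ t x → edge t x x ≡ false
edge-irrefl ● _ = refl
edge-irrefl (node _ l _) (inj₁ x) = edge-irrefl l x
edge-irrefl (node _ _ r) (inj₂ x) = edge-irrefl r x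

any? : ∀ t {P : Vertex t → Set} → (∀ x → Dec (P x)) → Dec (∃ P)
any? ∅ P? = no λ ()
any? ● P? = map′ (tt ,_) (λ { (tt , p) → p }) (P? tt)
any? (node _ l r) P? =
  map′ (λ { (inj₁ (x , p)) → inj₁ x , p ; (inj₂ (x , p)) → inj₂ x , p })
       (λ { (inj₁ x , p) → inj₁ (x , p) ; (inj₂ x , p) → inj₂ (x , p) })
       (any? l (P? ∘ inj₁) ⊎-dec any? r (P? ∘ inj₂))

all? : ∀ t {P : Vertex t → Set} → (∀ x → Dec (P x)) → Dec (∀ x → P x)
all? ∅ P? = yes λ ()
all? ● P? = map′ (λ p _ → p) (λ p → p tt) (P? tt)
all? (node _ l r) P? =
  map′ (λ { (p , q) (inj₁ x) → p x ; (p , q) (inj₂ x) → q x })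
       (λ p → p ∘ inj₁ , p ∘ inj₂)
       (all? l (P? ∘ inj₁) ×-dec all? r (P? ∘ inj₂))

infix 4 _≟ᵛ_

_≟ᵛ_ : ∀ {t} (x y : Vertex t) → Dec (x ≡ y)
_≟ᵛ_ {●} tt tt = yes refl
_≟ᵛ_ {node _ _ _} (inj₁ x) (inj₁ y) = map′ (cong inj₁) inj₁-injective (x ≟ᵛ y)
_≟ᵛ_ {node _ _ _} (inj₂ x) (inj₂ y) = map′ (cong inj₂) inj₂-injective (x ≟ᵛ y)
_≟ᵛ_ {node _ _ _} (inj₁ _) (inj₂ _) = no λ ()
_≟ᵛ_ {node _ _ _} (inj₂ _) (inj₁ _) = no λ ()

left-↪ : ∀ b l r → edge l ↪ edge (node b l r)
left-↪ b l r = record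
  { to = inj₁ ; injective = inj₁-injective ; preserves = λ _ _ → refl }

right-↪ : ∀ b l r → edge r ↪ edge (node b l r)
right-↪ b l r = record
  { to = inj₂ ; injective = inj₂-injective ; preserves = λ _ _ → refl }

node-↪ : ∀ b {l l′ r r′} → edge l ↪ edge l′ → edge r ↪ edge r′ →
         edge (node b l r) ↪ edge (node b l′ r′)
node-↪ b f g = record
  { to        = Sum.map (to f) (to g)
  ; injective = λ
      { {inj₁ _} {inj₁ _} e → cong inj₁ (injective f (inj₁-injective e))
      ; {inj₂ _} {inj₂ _} e → cong inj₂ (injective g (inj₂-injective e)) }
  ; preserves = λ
      { (inj₁ x) (inj₁ y) → preserves f x y
      ; (inj₂ x) (inj₂ y) → preserves g x y
      ; (inj₁ _) (inj₂ _) → refl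
      ; (inj₂ _) (inj₁ _) → refl }
  }

node-≃ : ∀ b {l l′ r r′} → edge l ≃ edge l′ → edge r ≃ edge r′ →
         edge (node b l r) ≃ edge (node b l′ r′)
node-≃ b f g = record
  { embedding  = node-↪ b (embedding f) (embedding g)
  ; surjective = λ
      { (inj₁ y) → inj₁ (from f y) , cong inj₁ (to∘from f y)
      ; (inj₂ y) → inj₂ (from g y) , cong inj₂ (to∘from g y) }
  }

node-comm : ∀ b l r → edge (node b l r) ≃ edge (node b r l)
node-comm b l r = record
  { embedding = record
    { to        = Sum.swap
    ; injective = λ
        { {inj₁ _} {inj₁ _} refl → refl ; {inj₂ _} {inj₂ _} refl → refl }
    ; preserves = λ
        { (inj₁ _) (inj₁ _) → refl ; (inj₂ _) (inj₂ _) → refl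
        ; (inj₁ _) (inj₂ _) → refl ; (inj₂ _) (inj₁ _) → refl }
    }
  ; surjective = λ { (inj₁ y) → inj₂ y , refl ; (inj₂ y) → inj₁ y , refl }
  }

node-assoc : ∀ b l m r → edge (node b (node b l m) r) ≃ edge (node b l (node b m r))
node-assoc b l m r = record
  { embedding = record
    { to        = Sum.assocʳ
    ; injective = λ
        { {inj₁ (inj₁ _)} {inj₁ (inj₁ _)} refl → refl
        ; {inj₁ (inj₂ _)} {inj₁ (inj₂ _)} refl → refl
        ; {inj₂ _} {inj₁ (inj₁ _)} ()
        ; {inj₂ _} {inj₁ (inj₂ _)} ()
        ; {inj₂ _} {inj₂ _} refl → refl }
    ; preserves = λ
        { (inj₁ (inj₁ _)) (inj₁ (inj₁ _)) → refl
        ; (inj₁ (inj₁ _)) (inj₁ (inj₂ _)) → refl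
        ; (inj₁ (inj₂ _)) (inj₁ (inj₁ _)) → refl
        ; (inj₁ (inj₂ _)) (inj₁ (inj₂ _)) → refl
        ; (inj₁ (inj₁ _)) (inj₂ _) → refl
        ; (inj₁ (inj₂ _)) (inj₂ _) → refl
        ; (inj₂ _) (inj₁ (inj₁ _)) → refl
        ; (inj₂ _) (inj₁ (inj₂ _)) → refl
        ; (inj₂ _) (inj₂ _) → refl }
    }
  ; surjective = λ
      { (inj₁ y) → inj₁ (inj₁ y) , refl
      ; (inj₂ (inj₁ y)) → inj₁ (inj₂ y) , refl
      ; (inj₂ (inj₂ y)) → inj₂ y , refl }
  }

∅-identityʳ : ∀ b t → edge t ≃ edge (node b t ∅)
∅-identityʳ b t = record
  { embedding = left-↪ b t ∅ ; surjective = λ { (inj₁ y) → y , refl } }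

∅-identityˡ : ∀ b t → edge t ≃ edge (node b ∅ t)
∅-identityˡ b t = record
  { embedding = right-↪ b ∅ t ; surjective = λ { (inj₂ y) → y , refl } }

∅-↪ : ∀ t → edge ∅ ↪ edge t
∅-↪ t = record { to = λ () ; injective = λ { {()} } ; preserves = λ () }

-- Deleting vertices from a cotree

restrict : ∀ t → (Vertex t → Bool) → Cotree
restrict ∅ p = ∅
restrict ● p = if p tt then ● else ∅
restrict (node b l r) p = node b (restrict l (p ∘ inj₁)) (restrict r (p ∘ inj₂))

restrict-↪ : ∀ t p → edge (restrict t p) ↪ edge t
restrict-↪ ∅ p = embedding ≃-refl
restrict-↪ ● p with p tt
... | true  = embedding ≃-refl
... | false = ∅-↪ ●
restrict-↪ (node b l r) p = node-↪ b (restrict-↪ l _) (restrict-↪ r _)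

restrict-true : ∀ t (p : Vertex t → Bool) x → p (to (restrict-↪ t p) x) ≡ true
restrict-true ● p x with p tt in eq
restrict-true ● p tt | true = eq
restrict-true (node b l r) p (inj₁ x) = restrict-true l (p ∘ inj₁) x
restrict-true (node b l r) p (inj₂ x) = restrict-true r (p ∘ inj₂) x

restrict-onto : ∀ t (p : Vertex t → Bool) y → p y ≡ true → ∃ λ x → to (restrict-↪ t p) x ≡ y
restrict-onto ● p tt eq with p tt
... | true = tt , refl
restrict-onto (node b l r) p (inj₁ y) eq with restrict-onto l (p ∘ inj₁) y eq
... | x , e = inj₁ x , cong inj₁ e
restrict-onto (node b l r) p (inj₂ y) eq with restrict-onto r (p ∘ inj₂) y eq
... | x , e = inj₂ x , cong inj₂ e

restrict-factor : ∀ {V : Set} {R : V → V → Bool} t p (f : R ↪ edge t) →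
                  (∀ x → p (to f x) ≡ true) → R ↪ edge (restrict t p)
restrict-factor t p f q = record
  { to        = λ x → proj₁ (g x)
  ; injective = λ {x} {y} e → injective f
      (trans (sym (proj₂ (g x))) (trans (cong (to ι) e) (proj₂ (g y))))
  ; preserves = λ x y → trans (preserves f x y)
      (trans (sym (cong₂ (edge t) (proj₂ (g x)) (proj₂ (g y)))) (sym (preserves ι _ _)))
  }
  where
  ι = restrict-↪ t p
  g = λ x → restrict-onto t p (to f x) (q x)

-- Lexicographic order; the last argument is the answer for equal trees.
leq : Cotree → Cotree → Bool → Bool
leq ∅ ∅ k = k
leq ∅ _ k = true
leq ● ∅ k = false
leq ● ● k = k
leq ● _ k = true
leq (node b l r) (node c m s) k with b | c
... | false | true = true
... | true | false = false
... | _ | _ = leq l m (leq r s k)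
leq (node _ _ _) _ k = false

order : Bool → Cotree → Cotree → Bool → Cotree
order b x y true = node b x y
order b x y false = node b y x

-- The second tree is read as a right-nested chain of `b`-nodes sorted by `leq`. The end of the
-- chain is not a `b`-node and is left to `order`.
insert : Bool → Cotree → Cotree → Cotree
insert b x ∅ = x
insert b x ● = order b x ● (leq x ● true)
insert b x (node c l r) with b ≟ᵇ c
... | no _ = order b x (node c l r) (leq x (node c l r) true)
... | yes _ = if leq x l true then node b x (node c l r) else node b l (insert b x r)

merge : Bool → Cotree → Cotree → Cotree
merge b ∅ y = y
merge b ● y = insert b ● y
merge b (node c l r) y with b ≟ᵇ c
... | no _ = insert b (node c l r) y
... | yes _ = insert b l (merge b r y)

-- Drops ∅, associates to the right and sorts, so that isomorphic cographs get equal cotrees; of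
-- this, only nf t ≃ t is needed.
nf : Cotree → Cotree
nf ∅ = ∅
nf ● = ●
nf (node b l r) = merge b (nf l) (nf r)

order-≃ : ∀ b x y c → edge (order b x y c) ≃ edge (node b x y)
order-≃ b x y true = ≃-refl
order-≃ b x y false = node-comm b y x

node-swapˡ : ∀ b l m r → edge (node b l (node b m r)) ≃ edge (node b m (node b l r))
node-swapˡ b l m r = ≃-trans (≃-sym (node-assoc b l m r))
  (≃-trans (node-≃ b (node-comm b l m) ≃-refl) (node-assoc b m l r))

insert-≃ : ∀ b x y → edge (insert b x y) ≃ edge (node b x y)
insert-≃ b x ∅ = ∅-identityʳ b x
insert-≃ b x ● = order-≃ b x ● _
insert-≃ b x (node c l r) with b ≟ᵇ c
... | no _ = order-≃ b x (node c l r) _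
... | yes refl with leq x l true
...   | true  = ≃-refl
...   | false = ≃-trans (node-≃ b ≃-refl (insert-≃ b x r)) (node-swapˡ b l x r)

merge-≃ : ∀ b x y → edge (merge b x y) ≃ edge (node b x y)
merge-≃ b ∅ y = ∅-identityˡ b y
merge-≃ b ● y = insert-≃ b ● y
merge-≃ b (node c l r) y with b ≟ᵇ c
... | no _ = insert-≃ b (node c l r) y
... | yes refl = ≃-trans (insert-≃ b l (merge b r y))
    (≃-trans (node-≃ b ≃-refl (merge-≃ b r y)) (≃-sym (node-assoc b l r y)))

nf-≃ : ∀ t → edge (nf t) ≃ edge t
nf-≃ ∅ = ≃-refl
nf-≃ ● = ≃-refl
nf-≃ (node b l r) = ≃-trans (merge-≃ b (nf l) (nf r)) (node-≃ b (nf-≃ l) (nf-≃ r))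

-- The state of a cotree

-- Bounds 0, 1, ∞ on the number of parts of the complete multipartite side.
data Bound : Set where
  none one many : Bound

State : Set
State = ℕ × ℕ × ℕ

-- cost (state t) s is the least k ≤ 2 for which t is (s,k)-polar, and 3 if there is none.
cost : State → Bound → ℕ
cost (x , y , z) none = x
cost (x , y , z) one  = y
cost (x , y , z) many = z

-- Clusters of the two parts stay apart in a disjoint union, whereas in a join two nonempty
-- clusters must be single cliques, which then merge.
combine : Bool → ℕ → ℕ → ℕ
combine false m n = 3 ⊓ (m + n)
combine true zero n = n
combine true (suc m) zero = suc m
combine true 1 1 = 1
combine true (suc m) (suc n) = 3

-- These are the splits in which the multipartite side meets both parts. Across a union its vertices
-- are nonadjacent, so all of them share one class; across a join no class is shared, which a single
-- class cannot satisfy.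
extraSplits : Bool → Bound → List (Bound × Bound)
extraSplits false none = []
extraSplits false one  = (one , one) ∷ []
extraSplits false many = (one , one) ∷ []
extraSplits true  many = (many , many) ∷ []
extraSplits true  _    = []

splits : Bool → Bound → List (Bound × Bound)
splits b s = (s , none) ∷ (none , s) ∷ extraSplits b s

minCost : Bool → State → State → List (Bound × Bound) → ℕ
minCost b x y [] = 3
minCost b x y ((s , s′) ∷ ps) = combine b (cost x s) (cost y s′) ⊓ minCost b x y ps

join : Bool → State → State → State
join b x y =
  minCost b x y (splits b none) , minCost b x y (splits b one) , minCost b x y (splits b many)

state : Cotree → State
state ∅ = 0 , 0 , 0
state ● = 1 , 0 , 0
state (node b l r) = join b (state l) (state r)

_≟ˢ_ : (x y : State) → Dec (x ≡ y)
_≟ˢ_ = ≡-dec ℕₚ._≟_ (≡-dec ℕₚ._≟_ ℕₚ._≟_)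

-- For e = false the side labelled true is complete multipartite, for e = true the side labelled
-- false is a cluster; in both cases two vertices share a label iff their adjacency is e.
Labelling : ∀ {V : Set} → Bool → ℕ∞ → (V → V → Bool) → (V → Bool) → Set
Labelling {V} e n R side = Σ (V → ℕ) λ c →
  (∀ u → side u ≡ not e → c u <∞ n) ×
  (∀ u v → side u ≡ not e → side v ≡ not e → u ≢ v → (R u v ≡ e ⇔ c u ≡ c v))

PolarRel : ∀ {V : Set} → ℕ∞ → ℕ∞ → (V → V → Bool) → Set
PolarRel {V} s k R = Σ (V → Bool) λ side → Labelling false s R side × Labelling true k R side

Labelling-restrict : ∀ {V W : Set} {R : V → V → Bool} {S : W → W → Bool} {e n side} (f : R ↪ S) →
                     Labelling e n S side → Labelling e n R (side ∘ to f)
Labelling-restrict f (c , bound , label) = c ∘ to f , (λ u → bound (to f u)) , λ u v p q u≢v →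
  let eq = label (to f u) (to f v) p q (u≢v ∘ injective f) in
  mk⇔ (⇒ eq ∘ trans (sym (preserves f u v))) (trans (preserves f u v) ∘ ⇐ eq)

PolarRel-restrict : ∀ {V W : Set} {R : V → V → Bool} {S : W → W → Bool} {s k} → R ↪ S →
                    PolarRel s k S → PolarRel s k R
PolarRel-restrict f (side , A , B) = side ∘ to f , Labelling-restrict f A , Labelling-restrict f B

module _ {V : Set} {R : V → V → Bool} {e : Bool} {side : V → Bool} where

  Labelling-empty : (∀ u → side u ≢ not e) → Labelling e (fin 0) R side
  Labelling-empty ¬p = const 0 , (λ u p → ⊥-elim (¬p u p)) , λ u _ p → ⊥-elim (¬p u p)

  Labelling-single : ∀ {n} → 0 <∞ n →
    (∀ u v → side u ≡ not e → side v ≡ not e → u ≢ v → R u v ≡ e) → Labelling e n R side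
  Labelling-single 0<n same = const 0 , (λ _ _ → 0<n) , λ u v p q u≢v →
    mk⇔ (const refl) (const (same u v p q u≢v))

-- How at most n labels can be distributed over the two parts of node b: across the parts, labels
-- agree if b = e and differ if b = not e.
data Split (e : Bool) : Bool → (n n₁ n₂ : ℕ∞) → Set where
  left  : ∀ {b n} → Split e b n n (fin 0)
  right : ∀ {b n} → Split e b n (fin 0) n
  fuse  : ∀ {n} → 0 <∞ n → Split e e n (fin 1) (fin 1)
  two   : Split e (not e) (fin 2) (fin 1) (fin 1)
  inf   : Split e (not e) ∞ ∞ ∞

-- With at most two labels, both parts of `node (not e)` can be met only with one label each. From
-- three on there would be several ways, such as 1 + 2 and 2 + 1, and `Split` would need more
-- constructors.
Small : ℕ∞ → Set
Small (fin k) = k ≤ 2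
Small ∞       = ⊤

0<∞ : ∀ {x} n → x <∞ n → 0 <∞ n
0<∞ (fin _) x<n = ℕₚ.≤-trans (s≤s z≤n) x<n
0<∞ ∞       _   = tt

-- Used with `z` the label of a vertex in the other part: of two labels, one is taken there, so this
-- part has only one left.
pigeonhole₂ : ∀ {x y z} → x < 2 → y < 2 → z < 2 → x ≢ z → y ≢ z → x ≡ y
pigeonhole₂ {0} {0} _ _ _ _ _ = refl
pigeonhole₂ {1} {1} _ _ _ _ _ = refl
pigeonhole₂ {0} {1} {0} _ _ _ p _ = ⊥-elim (p refl)
pigeonhole₂ {0} {1} {1} _ _ _ _ q = ⊥-elim (q refl)
pigeonhole₂ {1} {0} {0} _ _ _ _ q = ⊥-elim (q refl)
pigeonhole₂ {1} {0} {1} _ _ _ p _ = ⊥-elim (p refl)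
pigeonhole₂ {suc (suc _)} (s≤s (s≤s ()))
pigeonhole₂ {_} {suc (suc _)} _ (s≤s (s≤s ()))
pigeonhole₂ {_} {_} {suc (suc _)} _ _ (s≤s (s≤s ()))

-- Splitting a labelling along the root

module _ (e b : Bool) (l r : Cotree) (side : Vertex (node b l r) → Bool) where

  sideˡ : Vertex l → Bool
  sideˡ = side ∘ inj₁

  sideʳ : Vertex r → Bool
  sideʳ = side ∘ inj₂

  -- Either one part contributes no vertex, or there are witnesses `u` and `v` in both. If `b` is
  -- `e`, comparison with the witness of the other part forces one common label. Otherwise the
  -- labels of each part avoid that witness's label, which excludes the bounds 0 and 1 and leaves
  -- one label per part for the bound 2.
  decompose : ∀ n → Small n → Labelling e n (edge (node b l r)) side →
    ∃₂ λ n₁ n₂ → Split e b n n₁ n₂ × Labelling e n₁ (edge l) sideˡ × Labelling e n₂ (edge r) sideʳ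
  decompose n small L@(c , bound , label)
    with any? l (λ u → sideˡ u ≟ᵇ not e) | any? r (λ v → sideʳ v ≟ᵇ not e)
  ... | no ¬l | _ = fin 0 , n , right ,
          Labelling-empty (λ u p → ¬l (u , p)) , Labelling-restrict (right-↪ b l r) L
  ... | yes _ | no ¬r = n , fin 0 , left ,
          Labelling-restrict (left-↪ b l r) L , Labelling-empty (λ u p → ¬r (u , p))
  ... | yes (u , p) | yes (v , q) with b ≟ᵇ e
  ...   | yes refl = fin 1 , fin 1 , fuse (0<∞ n (bound _ p)) ,
            Labelling-single (s≤s z≤n) (λ w w′ x x′ w≢w′ →
              ⇐ (label _ _ x x′ (w≢w′ ∘ inj₁-injective)) (trans (crossʳ w x) (sym (crossʳ w′ x′)))) ,
            Labelling-single (s≤s z≤n) (λ w w′ x x′ w≢w′ →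
              ⇐ (label _ _ x x′ (w≢w′ ∘ inj₂-injective)) (trans (crossˡ w x) (sym (crossˡ w′ x′))))
          where
          crossʳ : ∀ w → sideˡ w ≡ not e → c (inj₁ w) ≡ c (inj₂ v)
          crossʳ w x = ⇒ (label (inj₁ w) (inj₂ v) x q λ ()) refl
          crossˡ : ∀ w → sideʳ w ≡ not e → c (inj₂ w) ≡ c (inj₁ u)
          crossˡ w x = ⇒ (label (inj₂ w) (inj₁ u) x p λ ()) refl
  ...   | no b≢e = apart n small bound
          where
          crossʳ : ∀ w → sideˡ w ≡ not e → c (inj₁ w) ≢ c (inj₂ v)
          crossʳ w x = b≢e ∘ ⇐ (label (inj₁ w) (inj₂ v) x q λ ())
          crossˡ : ∀ w → sideʳ w ≡ not e → c (inj₂ w) ≢ c (inj₁ u)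
          crossˡ w x = b≢e ∘ ⇐ (label (inj₂ w) (inj₁ u) x p λ ())
          apart : ∀ n → Small n → (∀ w → side w ≡ not e → c w <∞ n) →
            ∃₂ λ n₁ n₂ → Split e b n n₁ n₂ × Labelling e n₁ (edge l) sideˡ × Labelling e n₂ (edge r) sideʳ
          apart (fin 0) _ bound with () ← bound _ p
          apart (fin 1) _ bound = ⊥-elim (crossʳ u p
            (trans (ℕₚ.n<1⇒n≡0 (bound _ p)) (sym (ℕₚ.n<1⇒n≡0 (bound _ q)))))
          apart (fin 2) _ bound = fin 1 , fin 1 , subst (λ b → Split e b _ _ _) (sym (¬-not b≢e)) two ,
            Labelling-single (s≤s z≤n) (λ w w′ x x′ w≢w′ →
              ⇐ (label _ _ x x′ (w≢w′ ∘ inj₁-injective))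
                (pigeonhole₂ (bound _ x) (bound _ x′) (bound _ q) (crossʳ w x) (crossʳ w′ x′))) ,
            Labelling-single (s≤s z≤n) (λ w w′ x x′ w≢w′ →
              ⇐ (label _ _ x x′ (w≢w′ ∘ inj₂-injective))
                (pigeonhole₂ (bound _ x) (bound _ x′) (bound _ p) (crossˡ w x) (crossˡ w′ x′)))
          apart (fin (suc (suc (suc _)))) (s≤s (s≤s ())) _
          -- Here `n` is a fresh variable, so the given labelling is repacked with the vacuous
          -- bound.
          apart ∞ _ _ = ∞ , ∞ , subst (λ b → Split e b _ _ _) (sym (¬-not b≢e)) inf ,
            Labelling-restrict (left-↪ b l r) L′ , Labelling-restrict (right-↪ b l r) L′
            where
            L′ : Labelling e ∞ (edge (node b l r)) side
            L′ = c , (λ _ _ → tt) , label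

-- Gluing labellings of the two parts

module _ (e : Bool) (l r : Cotree) where

  -- Labels must differ across the parts, so the left part gets even labels and the right part odd
  -- ones. This serves both `inf`, where any label is allowed, and `two`, where the label 0 becomes
  -- 0 on the left and 1 on the right.
  interleave : ∀ {n n₁ n₂} side →
    (∀ {x} → x <∞ n₁ → (2 * x) <∞ n) → (∀ {x} → x <∞ n₂ → suc (2 * x) <∞ n) →
    Labelling e n₁ (edge l) (side ∘ inj₁) → Labelling e n₂ (edge r) (side ∘ inj₂) →
    Labelling e n (edge (node (not e) l r)) side
  interleave {n} side h₁ h₂ (c₁ , bound₁ , label₁) (c₂ , bound₂ , label₂) = c , bound , label
    where
    c : Vertex l ⊎ Vertex r → ℕ
    c = [ (λ x → 2 * c₁ x) , (λ y → suc (2 * c₂ y)) ]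
    bound : ∀ u → side u ≡ not e → c u <∞ n
    bound (inj₁ u) p = h₁ (bound₁ u p)
    bound (inj₂ u) p = h₂ (bound₂ u p)
    label : ∀ u v → side u ≡ not e → side v ≡ not e → u ≢ v →
            edge (node (not e) l r) u v ≡ e ⇔ c u ≡ c v
    label (inj₁ u) (inj₁ v) p q u≢v =
      let eq = label₁ u v p q (u≢v ∘ cong inj₁) in
      mk⇔ (cong (2 *_) ∘ ⇒ eq) (⇐ eq ∘ ℕₚ.*-cancelˡ-≡ _ _ 2)
    label (inj₂ u) (inj₂ v) p q u≢v =
      let eq = label₂ u v p q (u≢v ∘ cong inj₂) in
      mk⇔ (cong (λ x → ℕ.suc (2 * x)) ∘ ⇒ eq) (⇐ eq ∘ ℕₚ.*-cancelˡ-≡ _ _ 2 ∘ ℕₚ.suc-injective)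
    label (inj₁ u) (inj₂ v) _ _ _ =
      mk⇔ (λ x → ⊥-elim (not-¬ refl (sym x))) (λ x → ⊥-elim (ℕₚ.even≢odd (c₁ u) (c₂ v) x))
    label (inj₂ u) (inj₁ v) _ _ _ =
      mk⇔ (λ x → ⊥-elim (not-¬ refl (sym x))) (λ x → ⊥-elim (ℕₚ.even≢odd (c₁ v) (c₂ u) (sym x)))

  compose : ∀ {b n n₁ n₂} side → Split e b n n₁ n₂ →
    Labelling e n₁ (edge l) (side ∘ inj₁) → Labelling e n₂ (edge r) (side ∘ inj₂) →
    Labelling e n (edge (node b l r)) side
  -- The label 0 on the right part is a dummy: the bound `fin 0` says that no vertex there is on
  -- this side.
  compose {b} {n} side left (c₁ , bound₁ , label₁) (_ , bound₂ , _) = [ c₁ , const 0 ] ,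
    (λ { (inj₁ u) p → bound₁ u p ; (inj₂ u) p → ⊥-elim (ℕₚ.n≮0 (bound₂ u p)) }) ,
    λ { (inj₁ u) (inj₁ v) p q u≢v → label₁ u v p q (u≢v ∘ cong inj₁)
      ; (inj₂ u) _ p _ _ → ⊥-elim (ℕₚ.n≮0 (bound₂ u p))
      ; (inj₁ _) (inj₂ v) _ q _ → ⊥-elim (ℕₚ.n≮0 (bound₂ v q)) }
  compose {b} {n} side right (_ , bound₁ , _) (c₂ , bound₂ , label₂) = [ const 0 , c₂ ] ,
    (λ { (inj₁ u) p → ⊥-elim (ℕₚ.n≮0 (bound₁ u p)) ; (inj₂ u) p → bound₂ u p }) ,
    λ { (inj₂ u) (inj₂ v) p q u≢v → label₂ u v p q (u≢v ∘ cong inj₂)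
      ; (inj₁ u) _ p _ _ → ⊥-elim (ℕₚ.n≮0 (bound₁ u p))
      ; (inj₂ _) (inj₁ v) _ q _ → ⊥-elim (ℕₚ.n≮0 (bound₁ v q)) }
  compose side (fuse 0<n) (c₁ , bound₁ , label₁) (c₂ , bound₂ , label₂) =
    Labelling-single 0<n λ
      { (inj₁ u) (inj₁ v) p q u≢v → ⇐ (label₁ u v p q (u≢v ∘ cong inj₁))
          (trans (ℕₚ.n<1⇒n≡0 (bound₁ u p)) (sym (ℕₚ.n<1⇒n≡0 (bound₁ v q))))
      ; (inj₂ u) (inj₂ v) p q u≢v → ⇐ (label₂ u v p q (u≢v ∘ cong inj₂))
          (trans (ℕₚ.n<1⇒n≡0 (bound₂ u p)) (sym (ℕₚ.n<1⇒n≡0 (bound₂ v q))))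
      ; (inj₁ _) (inj₂ _) _ _ _ → refl
      ; (inj₂ _) (inj₁ _) _ _ _ → refl }
  compose side two = interleave side
    (λ { {0} _ → s≤s z≤n ; {suc _} (s≤s ()) }) (λ { {0} _ → s≤s (s≤s z≤n) ; {suc _} (s≤s ()) })
  compose side inf = interleave side (λ _ → tt) (λ _ → tt)

⌊_⌋ : Bound → ℕ∞
⌊ none ⌋ = fin 0
⌊ one ⌋  = fin 1
⌊ many ⌋ = ∞

⌊⌋-small : ∀ s → Small ⌊ s ⌋
⌊⌋-small none = z≤n
⌊⌋-small one  = s≤s z≤n
⌊⌋-small many = tt

-- The constructor `two` does not arise, since no `Bound` denotes `fin 2`.
Split⇒splits : ∀ {b n₁ n₂} s → Split false b ⌊ s ⌋ n₁ n₂ →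
  ∃₂ λ s₁ s₂ → (s₁ , s₂) ∈ splits b s × n₁ ≡ ⌊ s₁ ⌋ × n₂ ≡ ⌊ s₂ ⌋
Split⇒splits none left  = none , none , here refl , refl , refl
Split⇒splits none right = none , none , here refl , refl , refl
Split⇒splits none (fuse ())
Split⇒splits one  left  = one , none , here refl , refl , refl
Split⇒splits one  right = none , one , there (here refl) , refl , refl
Split⇒splits one  (fuse _) = one , one , there (there (here refl)) , refl , refl
Split⇒splits many left  = many , none , here refl , refl , refl
Split⇒splits many right = none , many , there (here refl) , refl , refl
Split⇒splits many (fuse _) = one , one , there (there (here refl)) , refl , refl
Split⇒splits many inf = many , many , there (there (here refl)) , refl , refl

splits⇒Split : ∀ {s₁ s₂} b s → (s₁ , s₂) ∈ splits b s → Split false b ⌊ s ⌋ ⌊ s₁ ⌋ ⌊ s₂ ⌋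
splits⇒Split b s (here refl) = left
splits⇒Split b s (there (here refl)) = right
splits⇒Split false one  (there (there (here refl))) = fuse (s≤s z≤n)
splits⇒Split false many (there (there (here refl))) = fuse tt
splits⇒Split true  many (there (there (here refl))) = inf

combine-identityʳ : ∀ b m → combine b m 0 ≤ m
combine-identityʳ false m = ℕₚ.≤-trans (ℕₚ.m⊓n≤n 3 (m + 0)) (ℕₚ.≤-reflexive (ℕₚ.+-identityʳ m))
combine-identityʳ true zero    = z≤n
combine-identityʳ true (suc m) = ℕₚ.≤-refl

combine-identityˡ : ∀ b m → combine b 0 m ≤ m
combine-identityˡ false m = ℕₚ.m⊓n≤n 3 m
combine-identityˡ true  m = ℕₚ.≤-refl

-- Together with `combine⇒Split` this says that, for values up to 2, `combine` is the least number
-- of cliques over all splits. The hypotheses range over all `k₁` with `n₁ ≡ fin k₁` because the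
-- indices become known only once the constructor of the split is.
Split⇒combine : ∀ {b k n₁ n₂ m₁ m₂} → Small (fin k) → Split true b (fin k) n₁ n₂ →
  (∀ {k₁} → n₁ ≡ fin k₁ → k₁ ≤ 2 → m₁ ≤ k₁) → (∀ {k₂} → n₂ ≡ fin k₂ → k₂ ≤ 2 → m₂ ≤ k₂) →
  combine b m₁ m₂ ≤ k
Split⇒combine {b} {m₁ = m₁} k≤2 left h₁ h₂ with z≤n ← h₂ refl z≤n =
  ℕₚ.≤-trans (combine-identityʳ b m₁) (h₁ refl k≤2)
Split⇒combine {b} {m₂ = m₂} k≤2 right h₁ h₂ with z≤n ← h₁ refl z≤n =
  ℕₚ.≤-trans (combine-identityˡ b m₂) (h₂ refl k≤2)
Split⇒combine k≤2 (fuse 0<k) h₁ h₂ with h₁ refl (s≤s z≤n) | h₂ refl (s≤s z≤n)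
... | z≤n     | m₂≤1    = ℕₚ.≤-trans m₂≤1 0<k
... | s≤s z≤n | z≤n     = 0<k
... | s≤s z≤n | s≤s z≤n = 0<k
Split⇒combine {m₁ = m₁} {m₂} k≤2 two h₁ h₂ =
  ℕₚ.≤-trans (ℕₚ.m⊓n≤n 3 (m₁ + m₂)) (ℕₚ.+-mono-≤ (h₁ refl (s≤s z≤n)) (h₂ refl (s≤s z≤n)))

-- The assumption `k ≤ 2` excludes the value 3, which stands for every larger cost. Which split to
-- take is read off from which of the two costs vanish.
combine⇒Split : ∀ b m₁ m₂ {k} → k ≤ 2 → combine b m₁ m₂ ≤ k →
  ∃₂ λ k₁ k₂ → Split true b (fin k) (fin k₁) (fin k₂) × m₁ ≤ k₁ × m₂ ≤ k₂ × k₁ ≤ 2 × k₂ ≤ 2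
combine⇒Split false zero zero k≤2 h = _ , _ , left , z≤n , z≤n , k≤2 , z≤n
combine⇒Split false zero 1 k≤2 h = _ , _ , right , z≤n , h , z≤n , k≤2
combine⇒Split false zero 2 k≤2 h = _ , _ , right , z≤n , h , z≤n , k≤2
combine⇒Split false zero (suc (suc (suc _))) k≤2 h with s≤s (s≤s ()) ← ℕₚ.≤-trans h k≤2
combine⇒Split false 1 zero k≤2 h = _ , _ , left , h , z≤n , k≤2 , z≤n
combine⇒Split false 1 1 (s≤s (s≤s z≤n)) (s≤s (s≤s h)) =
  _ , _ , two , s≤s z≤n , s≤s z≤n , s≤s z≤n , s≤s z≤n
combine⇒Split false 1 (suc (suc _)) k≤2 h with s≤s (s≤s ()) ← ℕₚ.≤-trans h k≤2
combine⇒Split false 2 zero k≤2 h = _ , _ , left , h , z≤n , k≤2 , z≤n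
combine⇒Split false 2 (suc _) k≤2 h with s≤s (s≤s ()) ← ℕₚ.≤-trans h k≤2
combine⇒Split false (suc (suc (suc _))) _ k≤2 h with s≤s (s≤s ()) ← ℕₚ.≤-trans h k≤2
combine⇒Split true zero m₂ k≤2 h = _ , _ , right , z≤n , h , z≤n , k≤2
combine⇒Split true (suc m) zero k≤2 h = _ , _ , left , h , z≤n , k≤2 , z≤n
combine⇒Split true 1 1 k≤2 h =
  _ , _ , fuse h , s≤s z≤n , s≤s z≤n , s≤s z≤n , s≤s z≤n
combine⇒Split true 1 (suc (suc _)) k≤2 h with s≤s (s≤s ()) ← ℕₚ.≤-trans h k≤2
combine⇒Split true (suc (suc _)) (suc _) k≤2 h with s≤s (s≤s ()) ← ℕₚ.≤-trans h k≤2

minCost-≤ : ∀ b x y {s s′} ps → (s , s′) ∈ ps → minCost b x y ps ≤ combine b (cost x s) (cost y s′)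
minCost-≤ b x y (_ ∷ ps) (here refl) = ℕₚ.m⊓n≤m _ _
minCost-≤ b x y (_ ∷ ps) (there i) = ℕₚ.≤-trans (ℕₚ.m⊓n≤n _ _) (minCost-≤ b x y ps i)

minCost-attained : ∀ b x y {k} ps → k ≤ 2 → minCost b x y ps ≤ k →
  ∃₂ λ s s′ → (s , s′) ∈ ps × combine b (cost x s) (cost y s′) ≤ k
minCost-attained b x y [] k≤2 h with s≤s (s≤s ()) ← ℕₚ.≤-trans h k≤2
minCost-attained b x y ((s , s′) ∷ ps) k≤2 h
  with ℕₚ.⊓-sel (combine b (cost x s) (cost y s′)) (minCost b x y ps)
... | inj₁ e = s , s′ , here refl , subst (_≤ _) e h
... | inj₂ e with minCost-attained b x y ps k≤2 (subst (_≤ _) e h)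
...   | t , t′ , i , h′ = t , t′ , there i , h′

cost-join : ∀ b x y s → cost (join b x y) s ≡ minCost b x y (splits b s)
cost-join b x y none = refl
cost-join b x y one  = refl
cost-join b x y many = refl

-- The bound and `k` both vary in the induction, because a split hands other values to the two
-- parts.
cost-sound : ∀ t s {k} → k ≤ 2 → cost (state t) s ≤ k → PolarRel ⌊ s ⌋ (fin k) (edge t)
cost-sound ∅ s k≤2 h = (λ ()) , ((λ ()) , (λ ()) , λ ()) , ((λ ()) , (λ ()) , λ ())
-- A single vertex goes to the multipartite side whenever that side may be nonempty, so only `none`
-- costs a clique.
cost-sound ● none k≤2 h = const false ,
  (const 0 , (λ _ ()) , λ { tt tt _ _ x → ⊥-elim (x refl) }) ,
  (const 0 , (λ _ _ → h) , λ { tt tt _ _ x → ⊥-elim (x refl) })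
cost-sound ● one k≤2 h = const true ,
  (const 0 , (λ _ _ → s≤s z≤n) , λ { tt tt _ _ x → ⊥-elim (x refl) }) ,
  (const 0 , (λ _ ()) , λ { tt tt _ _ x → ⊥-elim (x refl) })
cost-sound ● many k≤2 h = const true ,
  (const 0 , (λ _ _ → tt) , λ { tt tt _ _ x → ⊥-elim (x refl) }) ,
  (const 0 , (λ _ ()) , λ { tt tt _ _ x → ⊥-elim (x refl) })
cost-sound (node b l r) s k≤2 h
  with s₁ , s₂ , i , h′ ← minCost-attained b (state l) (state r) (splits b s) k≤2
                            (subst (_≤ _) (cost-join b (state l) (state r) s) h)
  with k₁ , k₂ , sp , h₁ , h₂ , k₁≤2 , k₂≤2 ← combine⇒Split b _ _ k≤2 h′
  with side₁ , A₁ , B₁ ← cost-sound l s₁ k₁≤2 h₁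
  with side₂ , A₂ , B₂ ← cost-sound r s₂ k₂≤2 h₂
  = [ side₁ , side₂ ] , compose false l r _ (splits⇒Split b s i) A₁ A₂ , compose true l r _ sp B₁ B₂

cost-complete : ∀ t s {k} → k ≤ 2 → PolarRel ⌊ s ⌋ (fin k) (edge t) → cost (state t) s ≤ k
cost-complete ∅ none k≤2 _ = z≤n
cost-complete ∅ one  k≤2 _ = z≤n
cost-complete ∅ many k≤2 _ = z≤n
cost-complete ● none k≤2 (side , (_ , bound , _) , (_ , bound′ , _)) with side tt in eq
... | true  with () ← bound tt eq
... | false = ℕₚ.≤-trans (s≤s z≤n) (bound′ tt eq)
cost-complete ● one  k≤2 _ = z≤n
cost-complete ● many k≤2 _ = z≤n
cost-complete (node b l r) s k≤2 (side , A , B)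
  with _ , _ , spA , A₁ , A₂ ← decompose false b l r side ⌊ s ⌋ (⌊⌋-small s) A
  with _ , _ , spB , B₁ , B₂ ← decompose true b l r side _ k≤2 B
  with s₁ , s₂ , i , refl , refl ← Split⇒splits s spA
  = subst (_≤ _) (sym (cost-join b (state l) (state r) s))
      (ℕₚ.≤-trans (minCost-≤ b (state l) (state r) (splits b s) i)
        (Split⇒combine k≤2 spB
          (λ { refl k₁≤2 → cost-complete l s₁ k₁≤2 (_ , A₁ , B₁) })
          (λ { refl k₂≤2 → cost-complete r s₂ k₂≤2 (_ , A₂ , B₂) })))

-- Cographs are the graphs of cotrees

-- For `e = false` this is an induced P_4 in the complement. Distinctness of the vertices is not
-- asked for; in a graph it follows from the adjacencies.
IsPath : ∀ {V : Set} → Bool → (V → V → Bool) → (a b c d : V) → Set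
IsPath e R a b c d = (R a b ≡ e × R b c ≡ e × R c d ≡ e) ×
                     (R a c ≡ not e × R a d ≡ not e × R b d ≡ not e)

PathFree : ∀ {V : Set} → (V → V → Bool) → Set
PathFree R = ∀ a b c d → ¬ IsPath true R a b c d

PathFree-restrict : ∀ {V W : Set} {R : V → V → Bool} {S : W → W → Bool} → R ↪ S →
                    PathFree S → PathFree R
PathFree-restrict {R = R} {S} f free a b c d ((p , q , r) , (x , y , z)) = free _ _ _ _
  ((move p , move q , move r) , (move x , move y , move z))
  where
  move : ∀ {u v e} → R u v ≡ e → S (to f u) (to f v) ≡ e
  move {u} {v} = trans (sym (preserves f u v))

-- P₄ is self-complementary.
PathFree-complement : ∀ {V : Set} {R : V → V → Bool} → (∀ x y → R x y ≡ R y x) → PathFree R →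
                      ∀ e a b c d → ¬ IsPath e R a b c d
PathFree-complement symm free true  = free
PathFree-complement symm free false a b c d ((p , q , r) , (x , y , z)) = free c a d b
  ((trans (symm c a) x , y , trans (symm d b) z) , (r , trans (symm c b) q , p))

-- P_4 and its complement are both connected. If the four vertices met both children, some edge and
-- some non-edge would cross the root, and its label would be both `true` and `false`.
edge-pathFree : ∀ t → PathFree (edge t)
edge-pathFree ● _ _ _ _ ((() , _) , _)
edge-pathFree (node _ l _) (inj₁ a) (inj₁ b) (inj₁ c) (inj₁ d) = edge-pathFree l a b c d
edge-pathFree (node _ _ r) (inj₂ a) (inj₂ b) (inj₂ c) (inj₂ d) = edge-pathFree r a b c d
edge-pathFree (node _ _ _) (inj₁ _) (inj₂ _) (inj₁ _) (inj₁ _) ((refl , _) , (_ , _ , ()))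
edge-pathFree (node _ _ _) (inj₁ _) (inj₁ _) (inj₂ _) (inj₁ _) ((_ , refl , _) , (() , _))
edge-pathFree (node _ _ _) (inj₁ _) (inj₁ _) (inj₁ _) (inj₂ _) ((_ , _ , refl) , (_ , () , _))
edge-pathFree (node _ _ _) (inj₁ _) (inj₂ _) (inj₂ _) (inj₁ _) ((refl , _) , (() , _))
edge-pathFree (node _ _ _) (inj₁ _) (inj₂ _) (inj₁ _) (inj₂ _) ((refl , _) , (_ , () , _))
edge-pathFree (node _ _ _) (inj₁ _) (inj₁ _) (inj₂ _) (inj₂ _) ((_ , refl , _) , (() , _))
edge-pathFree (node _ _ _) (inj₁ _) (inj₂ _) (inj₂ _) (inj₂ _) ((refl , _) , (() , _))
edge-pathFree (node _ _ _) (inj₂ _) (inj₁ _) (inj₂ _) (inj₂ _) ((refl , _) , (_ , _ , ()))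
edge-pathFree (node _ _ _) (inj₂ _) (inj₂ _) (inj₁ _) (inj₂ _) ((_ , refl , _) , (() , _))
edge-pathFree (node _ _ _) (inj₂ _) (inj₂ _) (inj₂ _) (inj₁ _) ((_ , _ , refl) , (_ , () , _))
edge-pathFree (node _ _ _) (inj₂ _) (inj₁ _) (inj₁ _) (inj₂ _) ((refl , _) , (() , _))
edge-pathFree (node _ _ _) (inj₂ _) (inj₁ _) (inj₂ _) (inj₁ _) ((refl , _) , (_ , () , _))
edge-pathFree (node _ _ _) (inj₂ _) (inj₂ _) (inj₁ _) (inj₁ _) ((_ , refl , _) , (() , _))
edge-pathFree (node _ _ _) (inj₂ _) (inj₁ _) (inj₁ _) (inj₁ _) ((refl , _) , (() , _))

-- Adding a vertex to a cotree

extend : ∀ {V : Set} → (V → V → Bool) → (V → Bool) → Maybe V → Maybe V → Bool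
extend R N nothing  nothing  = false
extend R N nothing  (just y) = N y
extend R N (just x) nothing  = N x
extend R N (just x) (just y) = R x y

extend-↪ : ∀ {V W : Set} {R : V → V → Bool} {S : W → W → Bool} {N} (f : R ↪ S) →
           extend R (N ∘ to f) ↪ extend S N
extend-↪ f = record
  { to        = λ { nothing → nothing ; (just x) → just (to f x) }
  ; injective = λ { {nothing} {nothing} _ → refl
                  ; {just _} {just _} e → cong just (injective f (just-injective e)) }
  ; preserves = λ { nothing nothing → refl ; nothing (just _) → refl
                  ; (just _) nothing → refl ; (just x) (just y) → preserves f x y }
  }

extend-≃ : ∀ {V W : Set} {R : V → V → Bool} {S : W → W → Bool} {N} (f : R ≃ S) →
           extend R (N ∘ to (embedding f)) ≃ extend S N
extend-≃ f = record
  { embedding  = extend-↪ (embedding f)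
  ; surjective = λ { nothing → nothing , refl
                   ; (just y) → just (from f y) , cong just (to∘from f y) }
  }

-- The new vertex is joined to all of `l` in the way the root prescribes, so it can be moved into
-- the right child.
extend-rightmost : ∀ b l r N → (∀ x → N (inj₁ x) ≡ b) → ∀ {r′} →
  extend (edge r) (N ∘ inj₂) ≃ edge r′ → extend (edge (node b l r)) N ≃ edge (node b l r′)
extend-rightmost b l r N all {r′} f = record
  { embedding = record
    { to        = φ
    ; injective = λ
        { {nothing} {nothing} _ → refl
        ; {nothing} {just (inj₂ _)} e → old (injective g (inj₂-injective e))
        ; {just (inj₂ _)} {nothing} e → old (injective g (inj₂-injective e))
        ; {just (inj₁ _)} {just (inj₁ _)} refl → refl
        ; {just (inj₂ _)} {just (inj₂ _)} e → old (injective g (inj₂-injective e)) }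
    ; preserves = λ
        { nothing nothing → preserves g nothing nothing
        ; nothing (just (inj₁ x)) → all x
        ; nothing (just (inj₂ y)) → preserves g nothing (just y)
        ; (just (inj₁ x)) nothing → all x
        ; (just (inj₂ x)) nothing → preserves g (just x) nothing
        ; (just (inj₁ _)) (just (inj₁ _)) → refl
        ; (just (inj₁ _)) (just (inj₂ _)) → refl
        ; (just (inj₂ _)) (just (inj₁ _)) → refl
        ; (just (inj₂ x)) (just (inj₂ y)) → preserves g (just x) (just y) }
    }
  ; surjective = λ
      { (inj₁ x) → just (inj₁ x) , refl
      ; (inj₂ y) → back (from f y) , trans (φ-back (from f y)) (cong inj₂ (to∘from f y)) }
  }
  where
  g = embedding f
  back : Maybe (Vertex r) → Maybe (Vertex l ⊎ Vertex r)
  back nothing  = nothing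
  back (just y) = just (inj₂ y)
  old : ∀ {x y} → x ≡ y → back x ≡ back y
  old = cong back
  φ : Maybe (Vertex l ⊎ Vertex r) → Vertex l ⊎ Vertex r′
  φ nothing         = inj₂ (to g nothing)
  φ (just (inj₁ x)) = inj₁ x
  φ (just (inj₂ y)) = inj₂ (to g (just y))
  φ-back : ∀ y → φ (back y) ≡ inj₂ (to g y)
  φ-back nothing  = refl
  φ-back (just _) = refl

-- The vertices whose adjacency to the new one differs from b form a module, which
-- splits off together with the new vertex.
extend-module : ∀ b t N → (∀ x y → N x ≡ not b → N y ≡ b → edge t x y ≡ b) →
  ∃ λ t′ → extend (edge t) N ≃ edge t′
extend-module b t N cross = t′ , ≃-sym iso
  where
  differ agree : Vertex t → Bool
  differ x = does (N x ≟ᵇ not b)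
  agree x = does (N x ≟ᵇ b)
  cover : ∀ x → differ x ≡ true ⊎ agree x ≡ true
  cover x with N x ≟ᵇ b
  ... | yes e = inj₂ refl
  ... | no ≢b = inj₁ (dec-true (N x ≟ᵇ not b) (¬-not ≢b))
  D A t′ : Cotree
  D = restrict t differ
  A = restrict t agree
  t′ = node b (node (not b) ● D) A
  d : edge D ↪ edge t
  d = restrict-↪ t differ
  a : edge A ↪ edge t
  a = restrict-↪ t agree
  Nd : ∀ x → N (to d x) ≡ not b
  Nd x = from-does (_ ≟ᵇ _) (restrict-true t differ x)
  Na : ∀ x → N (to a x) ≡ b
  Na x = from-does (_ ≟ᵇ _) (restrict-true t agree x)
  disjoint : ∀ {x y} → to d x ≡ to a y → ⊥
  disjoint {x} {y} e = not-¬ refl (trans (sym (Na y)) (trans (cong N (sym e)) (Nd x)))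
  φ : Vertex t′ → Maybe (Vertex t)
  φ (inj₁ (inj₁ tt)) = nothing
  φ (inj₁ (inj₂ x))  = just (to d x)
  φ (inj₂ x)         = just (to a x)
  iso : edge t′ ≃ extend (edge t) N
  iso = record
    { embedding = record
      { to        = φ
      ; injective = λ
          { {inj₁ (inj₁ tt)} {inj₁ (inj₁ tt)} _ → refl
          ; {inj₁ (inj₂ _)} {inj₁ (inj₂ _)} e → cong (inj₁ ∘ inj₂) (injective d (just-injective e))
          ; {inj₁ (inj₂ _)} {inj₂ _} e → ⊥-elim (disjoint (just-injective e))
          ; {inj₂ _} {inj₁ (inj₂ _)} e → ⊥-elim (disjoint (sym (just-injective e)))
          ; {inj₂ _} {inj₁ (inj₁ tt)} ()
          ; {inj₂ _} {inj₂ _} e → cong inj₂ (injective a (just-injective e)) }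
      ; preserves = λ
          { (inj₁ (inj₁ tt)) (inj₁ (inj₁ tt)) → refl
          ; (inj₁ (inj₁ tt)) (inj₁ (inj₂ x)) → sym (Nd x)
          ; (inj₁ (inj₂ x)) (inj₁ (inj₁ tt)) → sym (Nd x)
          ; (inj₁ (inj₂ x)) (inj₁ (inj₂ y)) → preserves d x y
          ; (inj₁ (inj₁ tt)) (inj₂ y) → sym (Na y)
          ; (inj₂ x) (inj₁ (inj₁ tt)) → sym (Na x)
          ; (inj₁ (inj₂ x)) (inj₂ y) → sym (cross _ _ (Nd x) (Na y))
          ; (inj₂ x) (inj₁ (inj₂ y)) → sym (trans (edge-sym t _ _) (cross _ _ (Nd y) (Na x)))
          ; (inj₂ x) (inj₂ y) → preserves a x y }
      }
    ; surjective = onto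
    }
    where
    onto : ∀ y → ∃ λ x → φ x ≡ y
    onto nothing = inj₁ (inj₁ tt) , refl
    onto (just y) with cover y
    ... | inj₁ p with restrict-onto t differ y p
    ...   | x , e = inj₁ (inj₂ x) , cong just e
    onto (just y) | inj₂ p with restrict-onto t agree y p
    ...   | x , e = inj₂ x , cong just e

≢not⇒≡ : ∀ {x y} → x ≢ not y → x ≡ y
≢not⇒≡ {y = y} p = trans (¬-not p) (not-involutive y)

-- If the new vertex relates to one whole child as the root prescribes, it is inserted into the
-- other child. Otherwise both children contain a vertex where it deviates, and P_4-freeness gives
-- the hypothesis of `extend-module`.
extend-cotree : ∀ t N → PathFree (extend (edge t) N) → ∃ λ t′ → extend (edge t) N ≃ edge t′
extend-cotree ∅ N _ = ● , record
  { embedding = record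
    { to = λ _ → tt ; injective = λ { {nothing} {nothing} _ → refl }
    ; preserves = λ { nothing nothing → refl } }
  ; surjective = λ { tt → nothing , refl } }
-- With this choice of `b` the only vertex deviates and none agrees, so the cross condition is
-- vacuous.
extend-cotree ● N _ = extend-module (not (N tt)) ● N λ { tt tt p q → ⊥-elim (not-¬ q p) }
extend-cotree (node b l r) N free
  with any? l (λ x → N (inj₁ x) ≟ᵇ not b) | any? r (λ x → N (inj₂ x) ≟ᵇ not b)
... | no ¬l | _ =
  let r′ , f = extend-cotree r (N ∘ inj₂) (PathFree-restrict (extend-↪ (right-↪ b l r)) free)
  in node b l r′ , extend-rightmost b l r N (λ x → ≢not⇒≡ (λ e → ¬l (x , e))) f
... | yes _ | no ¬r =
  let l′ , f = extend-cotree l (N ∘ inj₁) (PathFree-restrict (extend-↪ (left-↪ b l r)) free)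
      swap = node-comm b r l
  in node b r l′ , ≃-trans (≃-sym (extend-≃ swap))
       (extend-rightmost b r l (N ∘ to (embedding swap)) (λ x → ≢not⇒≡ (λ e → ¬r (x , e))) f)
... | yes (u , p) | yes (v , q) = extend-module b (node b l r) N cross
  where
  symm : ∀ x y → extend (edge (node b l r)) N x y ≡ extend (edge (node b l r)) N y x
  symm nothing nothing = refl
  symm nothing (just _) = refl
  symm (just _) nothing = refl
  symm (just x) (just y) = edge-sym (node b l r) x y
  nb : ∀ {x} → x ≡ b → x ≡ not (not b)
  nb e = trans e (sym (not-involutive b))
  -- Here `z` deviates and lies in the child opposite to `x` and `y`. If the pair `x`, `y` had
  -- colour `not b`, then `y`, `x`, the new vertex and `z` would form an induced P_4 in that colour.
  path : ∀ y x z → N x ≡ not b → N y ≡ b → N z ≡ not b → edge (node b l r) y z ≡ b →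
         edge (node b l r) x z ≡ b → edge (node b l r) x y ≡ b
  path y x z Nx Ny Nz yz xz with edge (node b l r) x y ≟ᵇ b
  ... | yes e = e
  ... | no ≢b = ⊥-elim (PathFree-complement symm free (not b) (just y) (just x) nothing (just z)
    ((trans (edge-sym (node b l r) y x) (¬-not ≢b) , Nx , Nz) , (nb Ny , nb yz , nb xz)))
  cross : ∀ x y → N x ≡ not b → N y ≡ b → edge (node b l r) x y ≡ b
  cross (inj₁ x) (inj₂ y) _ _ = refl
  cross (inj₂ x) (inj₁ y) _ _ = refl
  cross (inj₁ x) (inj₁ y) Nx Ny = path (inj₁ y) (inj₁ x) (inj₂ v) Nx Ny q refl refl
  cross (inj₂ x) (inj₂ y) Nx Ny = path (inj₂ y) (inj₂ x) (inj₁ u) Nx Ny p refl refl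

fin-cotree : ∀ n (R : Fin n → Fin n → Bool) → (∀ x y → R x y ≡ R y x) → (∀ x → R x x ≡ false) →
             PathFree R → ∃ λ t → R ≃ edge t
fin-cotree zero R _ _ _ = ∅ , record
  { embedding  = record { to = λ () ; injective = λ { {()} } ; preserves = λ () }
  ; surjective = λ () }
fin-cotree (suc n) R symm irr free =
  let t , f = fin-cotree n (λ x y → R (suc x) (suc y)) (λ _ _ → symm _ _) (λ _ → irr _)
                (λ a b c d → free _ _ _ _)
      -- The neighbourhood of vertex `zero`, carried over to the cotree of the remaining vertices.
      N = λ x → R zero (suc (from f x))
      g = ≃-trans split (≃-trans
            (extend-cong (λ x → cong (R zero ∘ suc) (sym (from∘to f x)))) (extend-≃ {N = N} f))
      t′ , h = extend-cotree t N (PathFree-restrict (embedding (≃-sym g)) free)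
  in t′ , ≃-trans g h
  where
  N₀ : Fin n → Bool
  N₀ x = R zero (suc x)
  extend-cong : ∀ {N} → (∀ x → N₀ x ≡ N x) →
    extend (λ x y → R (suc x) (suc y)) N₀ ≃ extend (λ x y → R (suc x) (suc y)) N
  extend-cong eq = record
    { embedding = record
      { to = id ; injective = id
      ; preserves = λ { nothing nothing → refl ; nothing (just y) → eq y
                      ; (just x) nothing → eq x ; (just _) (just _) → refl } }
    ; surjective = λ y → y , refl }
  split : R ≃ extend (λ x y → R (suc x) (suc y)) N₀
  split = record
    { embedding = record
      { to        = λ { zero → nothing ; (suc x) → just x }
      ; injective = λ { {zero} {zero} _ → refl ; {suc _} {suc _} refl → refl }
      ; preserves = λ { zero zero → irr zero ; zero (suc _) → refl
                      ; (suc x) zero → symm (suc x) zero ; (suc _) (suc _) → refl } }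
    ; surjective = λ { nothing → zero , refl ; (just x) → suc x , refl } }

Represents : Cotree → Graph → Set
Represents t G = adj G ≃ edge t

cograph⇒pathFree : ∀ G → Cograph G → PathFree (adj G)
cograph⇒pathFree G cog a b c d ((p , q , r) , (x , y , z)) = cog (f , (λ {i} {j} → inj i j) ,
  mk↔ₛ′ id id (λ _ → refl) (λ _ → refl) , pres)
  where
  f : Fin 4 → Fin (n G)
  f 0F = a
  f 1F = b
  f 2F = c
  f 3F = d
  pres : ∀ i j → adj G (f i) (f j) ≡ adj (P 4) i j
  pres 0F 0F = adj-irrefl G a
  pres 0F 1F = p
  pres 0F 2F = x
  pres 0F 3F = y
  pres 1F 0F = trans (adj-sym G b a) p
  pres 1F 1F = adj-irrefl G b
  pres 1F 2F = q
  pres 1F 3F = z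
  pres 2F 0F = trans (adj-sym G c a) x
  pres 2F 1F = trans (adj-sym G c b) q
  pres 2F 2F = adj-irrefl G c
  pres 2F 3F = r
  pres 3F 0F = trans (adj-sym G d a) y
  pres 3F 1F = trans (adj-sym G d b) z
  pres 3F 2F = trans (adj-sym G d c) r
  pres 3F 3F = adj-irrefl G d
  -- Distinct vertices of P₄ have distinct neighbourhoods, hence f is injective.
  separated : ∀ i j → i ≡ j ⊎ ∃ λ k → adj (P 4) i k ≢ adj (P 4) j k
  separated = from-does (Finₚ.all? λ i → Finₚ.all? λ j →
    i ≟ᶠ j ⊎-dec Finₚ.any? λ k → ¬? (adj (P 4) i k ≟ᵇ adj (P 4) j k)) refl
  inj : ∀ i j → f i ≡ f j → i ≡ j
  inj i j e with separated i j
  ... | inj₁ i≡j = i≡j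
  ... | inj₂ (k , ≢k) =
    ⊥-elim (≢k (trans (sym (pres i k)) (trans (cong (λ v → adj G v (f k)) e) (pres j k))))

pathFree⇒cograph : ∀ G → PathFree (adj G) → Cograph G
pathFree⇒cograph G free (f , _ , g , pres) =
  free _ _ _ _ ((edge′ 0F 1F , edge′ 1F 2F , edge′ 2F 3F) , (edge′ 0F 2F , edge′ 0F 3F , edge′ 1F 3F))
  where
  h : Fin 4 → Fin (n G)
  h = f ∘ Inverse.from g
  edge′ : ∀ i j → adj G (h i) (h j) ≡ adj (P 4) i j
  edge′ i j = trans (pres _ _)
    (cong₂ (adj (P 4)) (Inverse.strictlyInverseˡ g i) (Inverse.strictlyInverseˡ g j))

cograph⇒cotree : ∀ G → Cograph G → ∃ λ t → Represents t G
cograph⇒cotree G cog = fin-cotree (n G) (adj G) (adj-sym G) (adj-irrefl G) (cograph⇒pathFree G cog)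

cotree⇒cograph : ∀ {G} t → Represents t G → Cograph G
cotree⇒cograph {G} t f = pathFree⇒cograph G (PathFree-restrict (embedding f) (edge-pathFree t))

-- The listed graphs

P₃ᵗ C₄ᵗ K₂ᵗ : Cotree
P₃ᵗ = ● ⊠ (● ⊞ ●)
C₄ᵗ = (● ⊞ ●) ⊠ (● ⊞ ●)
K₂ᵗ = ● ⊠ ●

coᵗ : Cotree → Cotree
coᵗ ∅ = ∅
coᵗ ● = ●
coᵗ (node b l r) = node (not b) (coᵗ l) (coᵗ r)

infixr 8 _×ᵗ_
_×ᵗ_ : ℕ → Cotree → Cotree
zero ×ᵗ t = ∅
suc k ×ᵗ t = t ⊞ (k ×ᵗ t)

≅⇒≃ : ∀ {G H} → G ≅ H → adj G ≃ adj H
≅⇒≃ (f , pres) = record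
  { embedding = record
    { to        = Inverse.to f
    ; injective = λ {x} {y} e → trans (sym (Inverse.strictlyInverseʳ f x))
        (trans (cong (Inverse.from f) e) (Inverse.strictlyInverseʳ f y))
    ; preserves = pres }
  ; surjective = λ y → Inverse.from f y , Inverse.strictlyInverseˡ f y }

≃⇒≅ : ∀ {G H} → adj G ≃ adj H → G ≅ H
≃⇒≅ f = mk↔ₛ′ (to (embedding f)) (from f) (to∘from f) (from∘to f) , preserves (embedding f)

mkGraph-adj : ∀ m (r : Fin m → Fin m → Bool) → (∀ i j → r i j ≡ r j i) → (∀ i → r i i ≡ false) →
              ∀ i j → adj (mkGraph m r) i j ≡ r i j
mkGraph-adj m r symm irr i j with i ≟ᶠ j
... | yes refl = sym (irr i)
... | no _     = trans (cong (r i j ∨_) (symm j i)) (∨-idem (r i j))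

represents-node : ∀ x {s t} G H → Represents s G → Represents t H →
  Represents (node x s t) (mkGraph (n G + n H) (block (n G) (n H) (adj G) (adj H) x))
represents-node x {s} {t} G H f g = record
  { embedding = record
    { to        = φ ∘ splitAt (n G)
    ; injective = λ {i} {j} e → trans (sym (Finₚ.join-splitAt (n G) (n H) i))
        (trans (cong (joinᶠ (n G) (n H)) (φ-injective (splitAt (n G) i) (splitAt (n G) j) e))
          (Finₚ.join-splitAt (n G) (n H) j))
    ; preserves = λ i j → trans (mkGraph-adj _ B B-sym B-irrefl i j) (B-edge i j) }
  ; surjective = λ y → joinᶠ (n G) (n H) (ψ y) ,
      trans (cong φ (Finₚ.splitAt-join (n G) (n H) (ψ y))) (φ∘ψ y)
  }
  where
  B : Fin (n G + n H) → Fin (n G + n H) → Bool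
  B = block (n G) (n H) (adj G) (adj H) x
  φ : Fin (n G) ⊎ Fin (n H) → Vertex (node x s t)
  φ = Sum.map (to (embedding f)) (to (embedding g))
  ψ : Vertex (node x s t) → Fin (n G) ⊎ Fin (n H)
  ψ = Sum.map (from f) (from g)
  φ∘ψ : ∀ y → φ (ψ y) ≡ y
  φ∘ψ (inj₁ y) = cong inj₁ (to∘from f y)
  φ∘ψ (inj₂ y) = cong inj₂ (to∘from g y)
  φ-injective : ∀ u v → φ u ≡ φ v → u ≡ v
  φ-injective (inj₁ _) (inj₁ _) e = cong inj₁ (injective (embedding f) (inj₁-injective e))
  φ-injective (inj₂ _) (inj₂ _) e = cong inj₂ (injective (embedding g) (inj₂-injective e))
  B-sym : ∀ i j → B i j ≡ B j i
  B-sym i j with splitAt (n G) i | splitAt (n G) j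
  ... | inj₁ u | inj₁ v = adj-sym G u v
  ... | inj₂ u | inj₂ v = adj-sym H u v
  ... | inj₁ _ | inj₂ _ = refl
  ... | inj₂ _ | inj₁ _ = refl
  B-irrefl : ∀ i → B i i ≡ false
  B-irrefl i with splitAt (n G) i
  ... | inj₁ u = adj-irrefl G u
  ... | inj₂ u = adj-irrefl H u
  B-edge : ∀ i j → B i j ≡ edge (node x s t) (φ (splitAt (n G) i)) (φ (splitAt (n G) j))
  B-edge i j with splitAt (n G) i | splitAt (n G) j
  ... | inj₁ u | inj₁ v = preserves (embedding f) u v
  ... | inj₂ u | inj₂ v = preserves (embedding g) u v
  ... | inj₁ _ | inj₂ _ = refl
  ... | inj₂ _ | inj₁ _ = refl

module _ {s t : Cotree} {G H : Graph} where

  represents-+ : Represents s G → Represents t H → Represents (s ⊞ t) (G +ᴳ H)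
  represents-+ = represents-node false G H

  represents-⊕ : Represents s G → Represents t H → Represents (s ⊠ t) (G ⊕ᴳ H)
  represents-⊕ = represents-node true G H

represents-∅ : Represents ∅ ∅ᴳ
represents-∅ = record
  { embedding = record { to = λ () ; injective = λ { {()} } ; preserves = λ () } ; surjective = λ () }

represents-· : ∀ k {t} {G} → Represents t G → Represents (k ×ᵗ t) (k · G)
represents-· zero    f = represents-∅
represents-· (suc k) {G = G} f = represents-+ {G = G} {H = k · G} f (represents-· k {G = G} f)

co-adj : ∀ G {i j} → i ≢ j → adj (co G) i j ≡ not (adj G i j)
co-adj G {i} {j} i≢j with i ≟ᶠ j
... | yes i≡j = ⊥-elim (i≢j i≡j)
... | no _    = trans (cong (λ x → not (adj G i j) ∨ not x) (adj-sym G j i)) (∨-idem (not (adj G i j)))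

co-cong : ∀ {G H} → adj G ≃ adj H → adj (co G) ≃ adj (co H)
co-cong {G} {H} f = record
  { embedding = record
    { to        = to (embedding f)
    ; injective = injective (embedding f)
    ; preserves = pres }
  ; surjective = surjective f }
  where
  pres : ∀ i j → adj (co G) i j ≡ adj (co H) (to (embedding f) i) (to (embedding f) j)
  pres i j = by-cases (i ≟ᶠ j)
    (λ { refl → trans (adj-irrefl (co G) i) (sym (adj-irrefl (co H) _)) })
    (λ i≢j → trans (co-adj G i≢j) (trans (cong not (preserves (embedding f) i j))
               (sym (co-adj H (i≢j ∘ injective (embedding f))))))

co-involutive : ∀ G → adj (co (co G)) ≃ adj G
co-involutive G = record
  { embedding = record { to = id ; injective = id ; preserves = pres } ; surjective = λ y → y , refl }
  where
  pres : ∀ i j → adj (co (co G)) i j ≡ adj G i j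
  pres i j = by-cases (i ≟ᶠ j)
    (λ { refl → trans (adj-irrefl (co (co G)) i) (sym (adj-irrefl G i)) })
    (λ i≢j → trans (co-adj (co G) i≢j) (trans (cong not (co-adj G i≢j)) (not-involutive (adj G i j))))

-- The vertex types of `t` and `coᵗ t` coincide only once `t` is fully known, hence an explicit map.
coᵛ : ∀ t → Vertex t → Vertex (coᵗ t)
coᵛ ● x = x
coᵛ (node _ l r) = Sum.map (coᵛ l) (coᵛ r)

coᵛ-injective : ∀ t {x y} → coᵛ t x ≡ coᵛ t y → x ≡ y
coᵛ-injective ● e = e
coᵛ-injective (node _ l r) {inj₁ _} {inj₁ _} e = cong inj₁ (coᵛ-injective l (inj₁-injective e))
coᵛ-injective (node _ l r) {inj₂ _} {inj₂ _} e = cong inj₂ (coᵛ-injective r (inj₂-injective e))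

coᵛ-surjective : ∀ t y → ∃ λ x → coᵛ t x ≡ y
coᵛ-surjective ● y = y , refl
coᵛ-surjective (node _ l r) (inj₁ y) with coᵛ-surjective l y
... | x , e = inj₁ x , cong inj₁ e
coᵛ-surjective (node _ l r) (inj₂ y) with coᵛ-surjective r y
... | x , e = inj₂ x , cong inj₂ e

edge-coᵗ : ∀ t {x y} → x ≢ y → edge (coᵗ t) (coᵛ t x) (coᵛ t y) ≡ not (edge t x y)
edge-coᵗ ● x≢y = ⊥-elim (x≢y refl)
edge-coᵗ (node _ l _) {inj₁ _} {inj₁ _} x≢y = edge-coᵗ l (x≢y ∘ cong inj₁)
edge-coᵗ (node _ _ r) {inj₂ _} {inj₂ _} x≢y = edge-coᵗ r (x≢y ∘ cong inj₂)
edge-coᵗ (node _ _ _) {inj₁ _} {inj₂ _} _ = refl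
edge-coᵗ (node _ _ _) {inj₂ _} {inj₁ _} _ = refl

represents-co : ∀ {t G} → Represents t G → Represents (coᵗ t) (co G)
represents-co {t} {G} f = record
  { embedding = record
    { to        = φ
    ; injective = injective (embedding f) ∘ coᵛ-injective t
    ; preserves = pres }
  ; surjective = λ y → let x , e = coᵛ-surjective t y in
      from f x , trans (cong (coᵛ t) (to∘from f x)) e }
  where
  φ : Fin (n G) → Vertex (coᵗ t)
  φ = coᵛ t ∘ to (embedding f)
  pres : ∀ i j → adj (co G) i j ≡ edge (coᵗ t) (φ i) (φ j)
  pres i j = by-cases (i ≟ᶠ j)
    (λ { refl → trans (adj-irrefl (co G) i) (sym (edge-irrefl (coᵗ t) (φ i))) })
    (λ i≢j → trans (co-adj G i≢j) (trans (cong not (preserves (embedding f) i j))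
               (sym (edge-coᵗ t (i≢j ∘ injective (embedding f))))))

represents-by : ∀ t G (f : Fin (n G) → Vertex t) (g : Vertex t → Fin (n G)) →
  (∀ x → g (f x) ≡ x) → (∀ y → f (g y) ≡ y) → (∀ i j → adj G i j ≡ edge t (f i) (f j)) →
  Represents t G
represents-by t G f g g∘f f∘g pres = record
  { embedding = record
    { to        = f
    ; injective = λ {x} {y} e → trans (sym (g∘f x)) (trans (cong g e) (g∘f y))
    ; preserves = pres }
  ; surjective = λ y → g y , f∘g y }

represents-K₁ : Represents ● K₁
represents-K₁ = represents-by ● K₁ (λ _ → tt) (λ _ → 0F)
  (λ { 0F → refl }) (λ _ → refl) (λ { 0F 0F → refl })

represents-K₂ : Represents K₂ᵗ K₂
represents-K₂ = represents-by K₂ᵗ K₂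
  (λ { 0F → inj₁ tt ; 1F → inj₂ tt }) (λ { (inj₁ _) → 0F ; (inj₂ _) → 1F })
  (λ { 0F → refl ; 1F → refl }) (λ { (inj₁ _) → refl ; (inj₂ _) → refl })
  (λ { 0F 0F → refl ; 0F 1F → refl ; 1F 0F → refl ; 1F 1F → refl })

represents-P₃ : Represents P₃ᵗ P₃
represents-P₃ = represents-by P₃ᵗ P₃
  (λ { 0F → inj₂ (inj₁ tt) ; 1F → inj₁ tt ; 2F → inj₂ (inj₂ tt) })
  (λ { (inj₂ (inj₁ _)) → 0F ; (inj₁ _) → 1F ; (inj₂ (inj₂ _)) → 2F })
  (λ { 0F → refl ; 1F → refl ; 2F → refl })
  (λ { (inj₂ (inj₁ _)) → refl ; (inj₁ _) → refl ; (inj₂ (inj₂ _)) → refl })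
  (λ { 0F 0F → refl ; 0F 1F → refl ; 0F 2F → refl
     ; 1F 0F → refl ; 1F 1F → refl ; 1F 2F → refl
     ; 2F 0F → refl ; 2F 1F → refl ; 2F 2F → refl })

represents-C₄ : Represents C₄ᵗ C₄
represents-C₄ = represents-by C₄ᵗ C₄
  (λ { 0F → inj₁ (inj₁ tt) ; 1F → inj₂ (inj₁ tt) ; 2F → inj₁ (inj₂ tt) ; 3F → inj₂ (inj₂ tt) })
  (λ { (inj₁ (inj₁ _)) → 0F ; (inj₂ (inj₁ _)) → 1F ; (inj₁ (inj₂ _)) → 2F ; (inj₂ (inj₂ _)) → 3F })
  (λ { 0F → refl ; 1F → refl ; 2F → refl ; 3F → refl })
  (λ { (inj₁ (inj₁ _)) → refl ; (inj₂ (inj₁ _)) → refl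
     ; (inj₁ (inj₂ _)) → refl ; (inj₂ (inj₂ _)) → refl })
  (λ { 0F 0F → refl ; 0F 1F → refl ; 0F 2F → refl ; 0F 3F → refl
     ; 1F 0F → refl ; 1F 1F → refl ; 1F 2F → refl ; 1F 3F → refl
     ; 2F 0F → refl ; 2F 1F → refl ; 2F 2F → refl ; 2F 3F → refl
     ; 3F 0F → refl ; 3F 1F → refl ; 3F 2F → refl ; 3F 3F → refl })

-- Each listed expression is written once and yields the graph, its cotree and the proof that they
-- agree.
record Model : Set where
  constructor model
  field
    graph      : Graph
    cotree     : Cotree
    represents : Represents cotree graph
open Model

infixl 6 _+ᴹ_
infixl 7 _⊕ᴹ_
infixr 8 _·ᴹ_

K₁ᴹ K₂ᴹ P₃ᴹ C₄ᴹ : Model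
K₁ᴹ = model K₁ ● represents-K₁
K₂ᴹ = model K₂ K₂ᵗ represents-K₂
P₃ᴹ = model P₃ P₃ᵗ represents-P₃
C₄ᴹ = model C₄ C₄ᵗ represents-C₄

_+ᴹ_ _⊕ᴹ_ : Model → Model → Model
model G s f +ᴹ model H t g = model (G +ᴳ H) (s ⊞ t) (represents-+ {G = G} {H} f g)
model G s f ⊕ᴹ model H t g = model (G ⊕ᴳ H) (s ⊠ t) (represents-⊕ {G = G} {H} f g)

coᴹ : Model → Model
coᴹ (model G t f) = model (co G) (coᵗ t) (represents-co {G = G} f)

_·ᴹ_ : ℕ → Model → Model
k ·ᴹ model G t f = model (k · G) (k ×ᵗ t) (represents-· k {G = G} f)

-- There is no trailing `⊥` after the last model, so that `OneOf models₂ G` unfolds to `Fam2 G`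
-- itself, and likewise for `FamH` and `Fam5`.
OneOf : List Model → Graph → Set
OneOf []            G = ⊥
OneOf (m ∷ [])      G = G ≅ graph m
OneOf (m ∷ m′ ∷ ms) G = (G ≅ graph m) ⊎ OneOf (m′ ∷ ms) G

OneOf⇒Any : ∀ ms G → OneOf ms G → Any (λ m → G ≅ graph m) ms
OneOf⇒Any (m ∷ [])      G e        = here e
OneOf⇒Any (m ∷ m′ ∷ ms) G (inj₁ e) = here e
OneOf⇒Any (m ∷ m′ ∷ ms) G (inj₂ e) = there (OneOf⇒Any (m′ ∷ ms) G e)

Any⇒OneOf : ∀ ms G → Any (λ m → G ≅ graph m) ms → OneOf ms G
Any⇒OneOf (m ∷ [])      G (here e)  = e
Any⇒OneOf (m ∷ m′ ∷ ms) G (here e)  = inj₁ e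
Any⇒OneOf (m ∷ m′ ∷ ms) G (there i) = inj₂ (Any⇒OneOf (m′ ∷ ms) G i)

cotrees : List Model → List Cotree
cotrees = map (nf ∘ cotree)

RepresentedBy : List Cotree → Graph → Set
RepresentedBy ts G = Any (λ t → Represents t G) ts

OneOf⇔ : ∀ ms G → OneOf ms G ⇔ RepresentedBy (cotrees ms) G
OneOf⇔ ms G = mk⇔
  (map⁺ {f = nf ∘ cotree} ∘ Any.map (λ {m} e →
     ≃-trans (≅⇒≃ {G} {graph m} e) (≃-trans (represents m) (≃-sym (nf-≃ (cotree m)))))
   ∘ OneOf⇒Any ms G)
  (Any⇒OneOf ms G ∘ Any.map (λ {m} f →
     ≃⇒≅ {G} {graph m} (≃-trans f (≃-trans (nf-≃ (cotree m)) (≃-sym (represents m)))))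
   ∘ map⁻ {f = nf ∘ cotree})

co-P₃+ : Model → Model
co-P₃+ m = coᴹ (P₃ᴹ +ᴹ m)

modelsH models₁ models₂ models₃ models₄ models₅ : List Model
modelsH = (K₁ᴹ ⊕ᴹ C₄ᴹ) ∷ coᴹ (2 ·ᴹ P₃ᴹ) ∷ (K₂ᴹ ⊕ᴹ 2 ·ᴹ K₂ᴹ) ∷ (K₁ᴹ ⊕ᴹ (K₂ᴹ +ᴹ P₃ᴹ)) ∷ []
models₁ = map co-P₃+ modelsH
models₂ = (P₃ᴹ +ᴹ C₄ᴹ) ∷ (P₃ᴹ +ᴹ (K₁ᴹ ⊕ᴹ 2 ·ᴹ K₂ᴹ)) ∷ (2 ·ᴹ P₃ᴹ +ᴹ K₂ᴹ) ∷ []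
models₃ = (3 ·ᴹ K₁ᴹ +ᴹ (K₁ᴹ ⊕ᴹ C₄ᴹ)) ∷ f 1 2 ∷ f 2 1 ∷ f 3 0 ∷ []
  where
  f : ℕ → ℕ → Model
  f p q = p ·ᴹ K₁ᴹ +ᴹ q ·ᴹ K₂ᴹ +ᴹ (p ·ᴹ K₁ᴹ) ⊕ᴹ (p ·ᴹ K₁ᴹ)
models₄ =
  (2 ·ᴹ K₁ᴹ +ᴹ coᴹ (2 ·ᴹ P₃ᴹ))
  ∷ (2 ·ᴹ K₁ᴹ +ᴹ (K₁ᴹ ⊕ᴹ (P₃ᴹ +ᴹ K₂ᴹ)))
  ∷ (2 ·ᴹ K₁ᴹ +ᴹ (K₂ᴹ ⊕ᴹ 2 ·ᴹ K₂ᴹ))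
  ∷ (2 ·ᴹ K₁ᴹ +ᴹ (K₁ᴹ ⊕ᴹ (C₄ᴹ +ᴹ K₁ᴹ)))
  ∷ (2 ·ᴹ K₁ᴹ +ᴹ (K₁ᴹ ⊕ᴹ coᴹ (P₃ᴹ +ᴹ K₂ᴹ)))
  ∷ (2 ·ᴹ K₁ᴹ +ᴹ (coᴹ K₂ᴹ ⊕ᴹ (P₃ᴹ +ᴹ K₁ᴹ)))
  ∷ f 1 1 ∷ f 2 0 ∷ []
  where
  f : ℕ → ℕ → Model
  f p q = p ·ᴹ K₁ᴹ +ᴹ q ·ᴹ K₂ᴹ +ᴹ (2 ·ᴹ K₁ᴹ ⊕ᴹ (K₂ᴹ +ᴹ p ·ᴹ K₁ᴹ))
models₅ =
  (K₁ᴹ +ᴹ (K₁ᴹ ⊕ᴹ (K₁ᴹ +ᴹ 2 ·ᴹ K₂ᴹ)))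
  ∷ (K₁ᴹ +ᴹ (K₁ᴹ ⊕ᴹ (2 ·ᴹ K₁ᴹ +ᴹ C₄ᴹ)))
  ∷ (K₁ᴹ +ᴹ (K₁ᴹ ⊕ᴹ 2 ·ᴹ P₃ᴹ))
  ∷ (K₁ᴹ +ᴹ (K₁ᴹ ⊕ᴹ (K₁ᴹ +ᴹ coᴹ (K₂ᴹ +ᴹ P₃ᴹ))))
  ∷ []

-- `Fam1` lets `H` vary up to isomorphism, so it is not of the form `OneOf`. Forwards the
-- isomorphism is carried through sum and complement; backwards `H` is taken to be the listed graph
-- itself.
Fam1⇔ : ∀ G → Fam1 G ⇔ RepresentedBy (cotrees models₁) G
Fam1⇔ G = mk⇔ fwd bwd
  where
  fwd : Fam1 G → RepresentedBy (cotrees models₁) G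
  fwd (H , famH , e) = map⁺ {f = nf ∘ cotree} (map⁺ {f = co-P₃+} (Any.map (λ {m} h≅m →
    ≃-trans (≅⇒≃ {G} {co (P₃ +ᴳ H)} e)
      (≃-trans (represents-co {G = P₃ +ᴳ H} (represents-+ {G = P₃} {H} represents-P₃
                 (≃-trans (≅⇒≃ {H} {graph m} h≅m) (represents m))))
               (≃-sym (nf-≃ (cotree (co-P₃+ m)))))) (OneOf⇒Any modelsH H famH)))
  bwd : RepresentedBy (cotrees models₁) G → Fam1 G
  bwd i =
    let m , m∈ , e = find (map⁻ {f = co-P₃+} (OneOf⇒Any models₁ G (⇐ (OneOf⇔ models₁ G) i)))
    in graph m ,
       Any⇒OneOf modelsH (graph m) (Any.map (λ { refl → ≃⇒≅ {graph m} {graph m} ≃-refl }) m∈) , e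

Fam2⇔ : ∀ G → Fam2 G ⇔ RepresentedBy (cotrees models₂) G
Fam2⇔ = OneOf⇔ models₂

Fam3⇔ : ∀ G → Fam3 G ⇔ RepresentedBy (cotrees models₃) G
Fam3⇔ G = mk⇔ (⇒ (OneOf⇔ models₃ G) ∘ fwd) (bwd ∘ ⇐ (OneOf⇔ models₃ G))
  where
  fwd : Fam3 G → OneOf models₃ G
  fwd (inj₁ e) = inj₁ e
  fwd (inj₂ (1 , _ , _ , e)) = inj₂ (inj₁ e)
  fwd (inj₂ (2 , _ , _ , e)) = inj₂ (inj₂ (inj₁ e))
  fwd (inj₂ (3 , _ , _ , e)) = inj₂ (inj₂ (inj₂ e))
  fwd (inj₂ (suc (suc (suc (suc _))) , _ , s≤s (s≤s (s≤s ())) , _))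
  bwd : OneOf models₃ G → Fam3 G
  bwd (inj₁ e) = inj₁ e
  bwd (inj₂ (inj₁ e)) = inj₂ (1 , s≤s z≤n , s≤s z≤n , e)
  bwd (inj₂ (inj₂ (inj₁ e))) = inj₂ (2 , s≤s z≤n , s≤s (s≤s z≤n) , e)
  bwd (inj₂ (inj₂ (inj₂ e))) = inj₂ (3 , s≤s z≤n , s≤s (s≤s (s≤s z≤n)) , e)

Fam4⇔ : ∀ G → Fam4 G ⇔ RepresentedBy (cotrees models₄) G
Fam4⇔ G = mk⇔ (⇒ (OneOf⇔ models₄ G) ∘ under fwd) (under bwd ∘ ⇐ (OneOf⇔ models₄ G))
  where
  under : ∀ {A B C D E F X Y : Set} → (X → Y) →
          A ⊎ B ⊎ C ⊎ D ⊎ E ⊎ F ⊎ X → A ⊎ B ⊎ C ⊎ D ⊎ E ⊎ F ⊎ Y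
  under f = map₂ (map₂ (map₂ (map₂ (map₂ (map₂ f)))))
  Last : ℕ → Set
  Last p = G ≅ (p · K₁ +ᴳ (2 ∸ p) · K₂ +ᴳ (2 · K₁ ⊕ᴳ (K₂ +ᴳ p · K₁)))
  fwd : (Σ ℕ λ p → 1 ≤ p × p ≤ 2 × Last p) → Last 1 ⊎ Last 2
  fwd (1 , _ , _ , e) = inj₁ e
  fwd (2 , _ , _ , e) = inj₂ e
  fwd (suc (suc (suc _)) , _ , s≤s (s≤s ()) , _)
  bwd : Last 1 ⊎ Last 2 → Σ ℕ λ p → 1 ≤ p × p ≤ 2 × Last p
  bwd (inj₁ e) = 1 , s≤s z≤n , s≤s z≤n , e
  bwd (inj₂ e) = 2 , s≤s z≤n , s≤s (s≤s z≤n) , e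

Fam5⇔ : ∀ G → Fam5 G ⇔ RepresentedBy (cotrees models₅) G
Fam5⇔ = OneOf⇔ models₅

-- The multipartite condition is contraposed, which is possible because adjacency and equality of
-- labels are decidable. The restriction to distinct vertices is harmless because there are no
-- loops.
Polar⇔PolarRel : ∀ s k G → Polar s k G ⇔ PolarRel s k (adj G)
Polar⇔PolarRel s k G = mk⇔
  (λ { (side , (cA , boundA , labelA) , (cB , boundB , labelB)) → side ,
       (cA , boundA , λ u v p q _ → mk⇔
         (λ f → by-cases (cA u ℕₚ.≟ cA v) id (λ ≢c → ⊥-elim (absurd (⇐ (labelA u v p q) ≢c) f)))
         (λ e → ¬-not (λ t → ⇒ (labelA u v p q) t e))) ,
       (cB , boundB , λ u v p q u≢v → mk⇔
         (proj₁ ∘ ⇒ (labelB u v p q)) (λ e → ⇐ (labelB u v p q) (e , u≢v))) })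
  (λ { (side , (cA , boundA , labelA) , (cB , boundB , labelB)) → side ,
       (cA , boundA , λ u v p q → mk⇔
         (λ t e → absurd t (⇐ (labelA u v p q (loopless t)) e))
         (λ ≢c → ¬-not (≢c ∘ ⇒ (labelA u v p q (≢c ∘ cong cA))))) ,
       (cB , boundB , λ u v p q → mk⇔
         (λ t → ⇒ (labelB u v p q (loopless t)) t , loopless t)
         (λ { (e , u≢v) → ⇐ (labelB u v p q u≢v) e })) })
  where
  absurd : ∀ {x} → x ≡ true → x ≢ false
  absurd refl ()
  loopless : ∀ {u v} → adj G u v ≡ true → u ≢ v
  loopless {u} t refl = absurd t (adj-irrefl G u)

polar⇒cost : ∀ {G} t → edge t ↪ adj G → Polar ∞ (fin 2) G → cost (state t) many ≤ 2
polar⇒cost {G = G} t f p =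
  cost-complete t many ℕₚ.≤-refl (PolarRel-restrict f (⇒ (Polar⇔PolarRel ∞ (fin 2) G) p))

cost⇒polar : ∀ {G} t → adj G ↪ edge t → cost (state t) many ≤ 2 → Polar ∞ (fin 2) G
cost⇒polar {G} t f h =
  ⇐ (Polar⇔PolarRel ∞ (fin 2) G) (PolarRel-restrict f (cost-sound t many ℕₚ.≤-refl h))

-- Shrinking

-- ok tells from the state of a subtree whether the state of the whole tree is the desired one.
-- The state of the sibling is an argument of joinʳ and joinˡ so that it is evaluated only once.
joinʳ joinˡ : (State → Bool) → Bool → State → State → Bool
joinʳ ok b y x = ok (join b x y)
joinˡ ok b x y = ok (join b x y)

-- One greedy pass from left to right is enough: deleting vertices never raises a cost, so a vertex
-- whose deletion would change the state now would change it later as well. The right child is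
-- pruned against the state of the already pruned left child.
prune : (State → Bool) → Cotree → Cotree
pruneʳ : (State → Bool) → Bool → Cotree → Cotree → Cotree
prune ok ∅ = ∅
prune ok ● = if ok (state ∅) then ∅ else ●
prune ok (node b l r) = pruneʳ ok b (prune (joinʳ ok b (state r)) l) r
pruneʳ ok b l r = node b l (prune (joinˡ ok b (state l)) r)

prune-↪ : ∀ ok t → edge (prune ok t) ↪ edge t
prune-↪ ok ∅ = embedding ≃-refl
prune-↪ ok ● with ok (state ∅)
... | true  = ∅-↪ ●
... | false = embedding ≃-refl
prune-↪ ok (node b l r) = node-↪ b (prune-↪ _ l) (prune-↪ _ r)

obstructions₁ obstructions₂ obstructions₃ obstructions₄ obstructions₅ obstructions : List Cotree
obstructions₁ = cotrees models₁
obstructions₂ = cotrees models₂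
obstructions₃ = cotrees models₃
obstructions₄ = cotrees models₄
obstructions₅ = cotrees models₅
obstructions = obstructions₁ ++ obstructions₂ ++ obstructions₃ ++ obstructions₄ ++ obstructions₅

-- Membership is syntactic equality, so the trees are written in the form that `nf` produces.
polars : List Cotree
polars =
  ∅
  ∷ ●
  ∷ (● ⊞ ●)
  ∷ (● ⊠ ●)
  ∷ (● ⊞ ● ⊞ ●)
  ∷ (● ⊞ (● ⊠ ●))
  ∷ (● ⊠ (● ⊞ ●))
  ∷ (● ⊞ ● ⊞ (● ⊠ ●))
  ∷ (● ⊞ (● ⊠ (● ⊞ ●)))
  ∷ ((● ⊠ ●) ⊞ (● ⊠ ●))
  ∷ (● ⊠ (● ⊞ (● ⊠ ●)))
  ∷ ((● ⊞ ●) ⊠ (● ⊞ ●))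
  ∷ (● ⊞ (● ⊠ ●) ⊞ (● ⊠ ●))
  ∷ (● ⊞ ((● ⊞ ●) ⊠ (● ⊞ ●)))
  ∷ ((● ⊠ ●) ⊞ (● ⊠ (● ⊞ ●)))
  ∷ (● ⊠ ((● ⊠ ●) ⊞ (● ⊠ ●)))
  ∷ (● ⊠ (● ⊞ ●) ⊠ (● ⊞ ●))
  ∷ ((● ⊞ ●) ⊠ (● ⊞ (● ⊠ ●)))
  ∷ (● ⊞ ● ⊞ ((● ⊞ ●) ⊠ (● ⊞ ●)))
  ∷ (● ⊞ (● ⊠ (● ⊞ ●) ⊠ (● ⊞ ●)))
  ∷ (● ⊞ ((● ⊞ ●) ⊠ (● ⊞ (● ⊠ ●))))
  ∷ ((● ⊠ ●) ⊞ (● ⊠ ●) ⊞ (● ⊠ ●))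
  ∷ ((● ⊠ ●) ⊞ ((● ⊞ ●) ⊠ (● ⊞ ●)))
  ∷ ((● ⊠ (● ⊞ ●)) ⊞ (● ⊠ (● ⊞ ●)))
  ∷ (● ⊠ (● ⊞ (● ⊠ ●) ⊞ (● ⊠ ●)))
  ∷ (● ⊠ (● ⊞ ((● ⊞ ●) ⊠ (● ⊞ ●))))
  ∷ (● ⊠ ((● ⊠ ●) ⊞ (● ⊠ (● ⊞ ●))))
  ∷ (● ⊠ ● ⊠ ((● ⊠ ●) ⊞ (● ⊠ ●)))
  ∷ (● ⊠ (● ⊞ ●) ⊠ (● ⊞ (● ⊠ ●)))
  ∷ ((● ⊞ ●) ⊠ (● ⊞ ● ⊞ (● ⊠ ●)))
  ∷ ((● ⊞ ●) ⊠ (● ⊞ (● ⊠ (● ⊞ ●))))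
  ∷ ((● ⊞ ● ⊞ ●) ⊠ (● ⊞ ● ⊞ ●))
  ∷ ((● ⊞ (● ⊠ ●)) ⊠ (● ⊞ (● ⊠ ●)))
  ∷ (● ⊞ ● ⊞ (● ⊠ (● ⊞ ●) ⊠ (● ⊞ ●)))
  ∷ (● ⊞ (● ⊠ ●) ⊞ ((● ⊞ ●) ⊠ (● ⊞ ●)))
  ∷ (● ⊞ (● ⊠ (● ⊞ ((● ⊞ ●) ⊠ (● ⊞ ●)))))
  ∷ (● ⊞ (● ⊠ ((● ⊠ ●) ⊞ (● ⊠ (● ⊞ ●)))))
  ∷ (● ⊞ (● ⊠ ● ⊠ ((● ⊠ ●) ⊞ (● ⊠ ●))))
  ∷ (● ⊞ (● ⊠ (● ⊞ ●) ⊠ (● ⊞ (● ⊠ ●))))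
  ∷ (● ⊞ ((● ⊞ ●) ⊠ (● ⊞ ● ⊞ (● ⊠ ●))))
  ∷ (● ⊞ ((● ⊞ ●) ⊠ (● ⊞ (● ⊠ (● ⊞ ●)))))
  ∷ (● ⊞ ((● ⊞ ● ⊞ ●) ⊠ (● ⊞ ● ⊞ ●)))
  ∷ (● ⊞ ((● ⊞ (● ⊠ ●)) ⊠ (● ⊞ (● ⊠ ●))))
  ∷ ((● ⊠ ●) ⊞ ((● ⊞ ●) ⊠ (● ⊞ (● ⊠ ●))))
  ∷ (● ⊠ (● ⊞ ● ⊞ ((● ⊞ ●) ⊠ (● ⊞ ●))))
  ∷ (● ⊠ (● ⊞ ((● ⊞ ●) ⊠ (● ⊞ (● ⊠ ●)))))
  ∷ (● ⊠ ((● ⊠ (● ⊞ ●)) ⊞ (● ⊠ (● ⊞ ●))))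
  ∷ (● ⊞ ● ⊞ ((● ⊞ ● ⊞ ●) ⊠ (● ⊞ ● ⊞ ●)))
  ∷ []

shrinkTo : State → Cotree → Cotree
shrinkTo s t = nf (prune (λ x → does (x ≟ˢ s)) t)

shrink : Cotree → Cotree
shrink t = shrinkTo (state t) t

shrink-↪ : ∀ t → edge (shrink t) ↪ edge t
shrink-↪ t = ↪-trans (embedding (nf-≃ _)) (prune-↪ _ t)

-- The state has to be kept only in the first alternative, where the induction goes on; an
-- obstruction ends it.
Reduces : List Cotree → List Cotree → Cotree → Cotree → Set
Reduces ps os t r = (r ∈ ps × state r ≡ state t) ⊎ r ∈ os

Closed : List Cotree → List Cotree → Set
Closed ps os = All (λ l → All (λ r → ∀ b → Reduces ps os (node b l r) (shrink (node b l r))) ps) ps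

open DecMembership _≟ᵗ_ using (_∈?_)

closed? : ∀ ps os → Dec (Closed ps os)
closed? ps os = All.all? (λ l → All.all? (λ r → bool? λ b →
    reduces? (node b l r) (shrink (node b l r))) ps) ps
  where
  reduces? : ∀ t r → Dec (Reduces ps os t r)
  reduces? t r = (r ∈? ps ×-dec state r ≟ˢ state t) ⊎-dec r ∈? os
  bool? : ∀ {A : Bool → Set} → (∀ b → Dec (A b)) → Dec (∀ b → A b)
  bool? A? = map′ (λ { (f , t) false → f ; (f , t) true → t }) (λ h → h false , h true)
    (A? false ×-dec A? true)

abstract
  -- This is the finite check at the centre of the proof: 48 · 48 pairs under both operations,
  -- settled by evaluation.
  closed : Closed polars obstructions
  closed = from-does (closed? polars obstructions) refl

reduce : ∀ t → (∃ λ r → r ∈ polars × state r ≡ state t × edge r ↪ edge t) ⊎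
               (∃ λ r → r ∈ obstructions × edge r ↪ edge t)
reduce ∅ = inj₁ (∅ , here refl , refl , embedding ≃-refl)
reduce ● = inj₁ (● , there (here refl) , refl , embedding ≃-refl)
reduce (node b l r) with reduce l | reduce r
... | inj₂ (o , i , f) | _ = inj₂ (o , i , ↪-trans f (left-↪ b l r))
... | inj₁ _ | inj₂ (o , i , f) = inj₂ (o , i , ↪-trans f (right-↪ b l r))
... | inj₁ (l′ , i , el , f) | inj₁ (r′ , j , er , g)
  with All.lookup (All.lookup closed i) j b
...   | inj₁ (k , e) =
        inj₁ (_ , k , trans e (cong₂ (join b) el er) , ↪-trans (shrink-↪ _) (node-↪ b f g))
...   | inj₂ k = inj₂ (_ , k , ↪-trans (shrink-↪ _) (node-↪ b f g))

-- Minimality of the obstructions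

without : ∀ t → Vertex t → Cotree
without t x = restrict t (λ y → not (does (y ≟ᵛ x)))

abstract
  polars-polar : All (λ t → cost (state t) many ≤ 2) polars
  polars-polar = from-does (All.all? (λ t → cost (state t) many ≤? 2) polars) refl

  obstructions-nonpolar : All (λ t → ¬ cost (state t) many ≤ 2) obstructions
  obstructions-nonpolar = from-does (All.all? (λ t → ¬? (cost (state t) many ≤? 2)) obstructions) refl

  -- Single deletions suffice: a proper induced subgraph misses some vertex `x`, hence embeds in
  -- `without t x`, and polarity passes to induced subgraphs.
  obstructions-minimal : All (λ t → ∀ x → cost (state (without t x)) many ≤ 2) obstructions
  obstructions-minimal = from-does
    (All.all? (λ t → all? t (λ x → cost (state (without t x)) many ≤? 2)) obstructions) refl

-- Presents the removal of a vertex in the form in which `MinimalPolarObstruction` quantifies over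
-- subgraphs.
avoid : ∀ {k} (y : Fin k) → ∃ λ m → m < k × Σ (Fin m → Fin k) λ f →
        Injective _≡_ _≡_ f × (∀ z → z ≢ y → ∃ λ x → f x ≡ z)
avoid {suc m} y = m , ℕₚ.n<1+n m , punchIn y , (λ {i} {j} → Finₚ.punchIn-injective y i j) ,
  λ z z≢y → punchOut (z≢y ∘ sym) , Finₚ.punchIn-punchOut (z≢y ∘ sym)

-- If every vertex were hit, choosing preimages would inject `Fin k` into the smaller `Fin m`.
missed : ∀ {m k} (f : Fin m → Fin k) → m < k → ∃ λ y → ∀ x → f x ≢ y
missed {m} {k} f m<k with Finₚ.all? (λ y → Finₚ.any? (λ x → f x ≟ᶠ y))
... | yes onto = ⊥-elim (ℕₚ.<⇒≱ m<k (Finₚ.injective⇒≤ {f = proj₁ ∘ onto}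
      (λ {y} {z} e → trans (sym (proj₂ (onto y))) (trans (cong f e) (proj₂ (onto z))))))
... | no ¬onto with y , ¬hit ← Finₚ.¬∀⟶∃¬ k _ (λ y → Finₚ.any? (λ x → f x ≟ᶠ y)) ¬onto =
      y , λ x e → ¬hit (x , e)

-- A non-polar `G` contains an obstruction. If its embedding missed a vertex `y`, it would sit
-- inside `G` without `y`, which is polar by minimality; so the embedding is an isomorphism.
minObs⇒represented : ∀ G → CographMinObs ∞ (fin 2) G → RepresentedBy obstructions G
minObs⇒represented G (cog , nonpolar , minimal)
  with t , f ← cograph⇒cotree G cog | reduce t
... | inj₁ (r , i , e , g) = ⊥-elim (nonpolar (cost⇒polar {G} t (embedding f)
        (subst (λ s → cost s many ≤ 2) e (All.lookup polars-polar i))))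
... | inj₂ (r , i , g)
  with h ← ↪-trans g (embedding (≃-sym f)) | Finₚ.all? (λ y → any? r (λ x → to h x ≟ᶠ y))
...   | yes onto = Any.map (λ { refl → ≃-sym (record { embedding = h ; surjective = onto }) }) i
...   | no ¬onto
  with y , ¬hit ← Finₚ.¬∀⟶∃¬ (n G) _ (λ y → any? r (λ x → to h x ≟ᶠ y)) ¬onto
  with m , m<n , φ , φ-inj , pre ← avoid y
  = ⊥-elim (All.lookup obstructions-nonpolar i
      (polar⇒cost {induced G φ} r inside (minimal m φ φ-inj m<n)))
  where
  at : ∀ x → ∃ λ z → φ z ≡ to h x
  at x = pre (to h x) (λ e → ¬hit (x , e))
  inside : edge r ↪ adj (induced G φ)
  inside = record
    { to        = proj₁ ∘ at
    ; injective = λ {x} {x′} e → injective h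
        (trans (sym (proj₂ (at x))) (trans (cong φ e) (proj₂ (at x′))))
    ; preserves = λ x x′ → trans (preserves h x x′)
        (sym (cong₂ (adj G) (proj₂ (at x)) (proj₂ (at x′)))) }

represented⇒minObs : ∀ G → RepresentedBy obstructions G → CographMinObs ∞ (fin 2) G
represented⇒minObs G i with t , t∈ , f ← find i =
  cotree⇒cograph {G} t f ,
  (λ p → All.lookup obstructions-nonpolar t∈ (polar⇒cost {G = G} t (embedding (≃-sym f)) p)) ,
  λ m φ φ-inj m<n →
    let y , ¬hit = missed φ m<n
        x = to (embedding f) y
        g = ↪-trans (record { to = φ ; injective = φ-inj ; preserves = λ _ _ → refl }) (embedding f)
    in cost⇒polar {induced G φ} (without t x)
         (restrict-factor t _ g (λ z → cong not (dec-false (to g z ≟ᵛ x)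
           (λ e → ¬hit z (injective (embedding f) e)))))
         (All.lookup obstructions-minimal t∈ x)

-- Components and isolated vertices

-- Each label of one labelling is sent to the other labelling's label of a representative. This is
-- injective because both have reachability as their kernel.
Components-unique : ∀ G {c d} → Components G c → Components G d → c ≡ d
Components-unique G C D = ℕₚ.≤-antisym (half C D) (half D C)
  where
  half : ∀ {c d} → Components G c → Components G d → c ≤ d
  half (κ , κ-onto , κ⇔) (μ , _ , μ⇔) = Finₚ.injective⇒≤ {f = μ ∘ proj₁ ∘ κ-onto} λ {i} {j} e →
    trans (sym (proj₂ (κ-onto i))) (trans (⇐ (κ⇔ _ _) (⇒ (μ⇔ _ _) e)) (proj₂ (κ-onto j)))

-- `Reach` is tied to `Graph`; a `Star` over any relation can be transported along isomorphisms by
-- `gmap`.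
Linked : ∀ {V : Set} → (V → V → Bool) → V → V → Set
Linked R = Star (λ x y → R x y ≡ true)

Reach⇒Linked : ∀ {G u v} → Reach G u v → Linked (adj G) u v
Reach⇒Linked Defs.here       = ε
Reach⇒Linked (Defs.step e p) = e ◅ Reach⇒Linked p

Linked⇒Reach : ∀ {G u v} → Linked (adj G) u v → Reach G u v
Linked⇒Reach ε       = Defs.here
Linked⇒Reach (e ◅ p) = Defs.step e (Linked⇒Reach p)

-- A join is connected only if both of its sides are inhabited or one of them already settles the
-- matter; excluding `∅` makes the count in `components` correct.
Full : Cotree → Set
Full ∅ = ⊥
Full ● = ⊤
Full (node _ l r) = Full l × Full r

full? : ∀ t → Dec (Full t)
full? ∅ = no id
full? ● = yes tt
full? (node _ l r) = full? l ×-dec full? r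

vertex : ∀ t → Full t → Vertex t
vertex ● _ = tt
vertex (node _ l r) (p , _) = inj₁ (vertex l p)

components : Cotree → ℕ
components ∅ = 0
components ● = 1
components (l ⊞ r) = components l + components r
components (l ⊠ r) = 1

component : ∀ t → Vertex t → Fin (components t)
component ● _ = zero
component (l ⊞ r) (inj₁ x) = component l x ↑ˡ components r
component (l ⊞ r) (inj₂ x) = components l ↑ʳ component r x
component (l ⊠ r) _ = zero

component-onto : ∀ t → Full t → ∀ k → ∃ λ x → component t x ≡ k
component-onto ● _ zero = tt , refl
component-onto (l ⊠ r) p zero = vertex (l ⊠ r) p , refl
component-onto (l ⊞ r) (p , q) k with splitAt (components l) k in eq
... | inj₁ i = let x , e = component-onto l p i in
      inj₁ x , trans (cong (_↑ˡ components r) e) (Finₚ.splitAt⁻¹-↑ˡ eq)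
... | inj₂ i = let x , e = component-onto r q i in
      inj₂ x , trans (cong (components l ↑ʳ_) e) (Finₚ.splitAt⁻¹-↑ʳ eq)

↑ˡ≢↑ʳ : ∀ {m k} (i : Fin m) (j : Fin k) → i ↑ˡ k ≢ m ↑ʳ j
↑ˡ≢↑ʳ {m} {k} i j e
  with () ← trans (sym (Finₚ.splitAt-↑ˡ m i k)) (trans (cong (splitAt m) e) (Finₚ.splitAt-↑ʳ m k j))

component-linked : ∀ t → Full t → ∀ x y → component t x ≡ component t y → Linked (edge t) x y
component-linked ● _ _ _ _ = ε
component-linked (l ⊞ r) (p , _) (inj₁ x) (inj₁ y) e =
  gmap inj₁ id (component-linked l p x y (Finₚ.↑ˡ-injective _ _ _ e))
component-linked (l ⊞ r) (_ , q) (inj₂ x) (inj₂ y) e =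
  gmap inj₂ id (component-linked r q x y (Finₚ.↑ʳ-injective _ _ _ e))
component-linked (l ⊞ r) _ (inj₁ x) (inj₂ y) e = ⊥-elim (↑ˡ≢↑ʳ _ _ e)
component-linked (l ⊞ r) _ (inj₂ x) (inj₁ y) e = ⊥-elim (↑ˡ≢↑ʳ _ _ (sym e))
component-linked (l ⊠ r) _ (inj₁ _) (inj₂ _) _ = refl ◅ ε
component-linked (l ⊠ r) _ (inj₂ _) (inj₁ _) _ = refl ◅ ε
-- Two vertices on the same side of a join are linked through any vertex of the other side.
component-linked (l ⊠ r) (_ , q) (inj₁ x) (inj₁ y) _ = _◅_ {j = inj₂ (vertex r q)} refl (refl ◅ ε)
component-linked (l ⊠ r) (p , _) (inj₂ x) (inj₂ y) _ = _◅_ {j = inj₁ (vertex l p)} refl (refl ◅ ε)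

component-edge : ∀ t x y → edge t x y ≡ true → component t x ≡ component t y
component-edge (l ⊞ r) (inj₁ x) (inj₁ y) e = cong (_↑ˡ components r) (component-edge l x y e)
component-edge (l ⊞ r) (inj₂ x) (inj₂ y) e = cong (components l ↑ʳ_) (component-edge r x y e)
component-edge (l ⊠ r) _ _ _ = refl

linked-component : ∀ t {x y} → Linked (edge t) x y → component t x ≡ component t y
linked-component t ε = refl
linked-component t (e ◅ p) = trans (component-edge t _ _ e) (linked-component t p)

represented-components : ∀ G t → Full t → Represents t G → Components G (components t)
represented-components G t full f = component t ∘ φ ,
  (λ k → let x , e = component-onto t full k in
     from f x , trans (cong (component t) (to∘from f x)) e) ,
  λ u v → mk⇔
    (λ e → Linked⇒Reach (subst₂ (Linked (adj G)) (from∘to f u) (from∘to f v)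
      (gmap (from f) (λ {x} {y} → trans (sym (preserves (embedding (≃-sym f)) x y)))
        (component-linked t full (φ u) (φ v) e))))
    (λ p → linked-component t
      (gmap φ (λ {x} {y} → trans (sym (preserves (embedding f) x y))) (Reach⇒Linked p)))
  where
  φ : Fin (n G) → Vertex t
  φ = to (embedding f)

IsolatedRel : ∀ {V : Set} → (V → V → Bool) → V → Set
IsolatedRel R x = ∀ y → R x y ≡ false

isolated? : ∀ t x → Dec (IsolatedRel (edge t) x)
isolated? t x = all? t (λ y → edge t x y ≟ᵇ false)

IsolatedRel-from : ∀ {V W : Set} {R : V → V → Bool} {S : W → W → Bool} (f : R ≃ S) {x} →
                   IsolatedRel S x → IsolatedRel R (from f x)
IsolatedRel-from {S = S} f {x} iso y = trans (preserves (embedding f) _ y)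
  (trans (cong (λ z → S z (to (embedding f) y)) (to∘from f x)) (iso _))

HasIsolatedᵗ ExactlyOneIsolatedᵗ : Cotree → Set
HasIsolatedᵗ t = ∃ (IsolatedRel (edge t))
ExactlyOneIsolatedᵗ t = ∃ λ x → IsolatedRel (edge t) x × (∀ y → IsolatedRel (edge t) y → y ≡ x)

hasIsolated? : ∀ t → Dec (HasIsolatedᵗ t)
hasIsolated? t = any? t (isolated? t)

exactlyOneIsolated? : ∀ t → Dec (ExactlyOneIsolatedᵗ t)
exactlyOneIsolated? t = any? t λ x → isolated? t x ×-dec all? t λ y → isolated? t y →-dec y ≟ᵛ x

module _ {G : Graph} {t : Cotree} (f : Represents t G) where

  represented-isolated : HasIsolatedᵗ t → HasIsolated G
  represented-isolated (x , iso) = from f x , IsolatedRel-from f iso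

  isolated-represented : HasIsolated G → HasIsolatedᵗ t
  isolated-represented (x , iso) = _ , IsolatedRel-from (≃-sym f) iso

  represented-exactlyOne : ExactlyOneIsolatedᵗ t → ExactlyOneIsolated G
  represented-exactlyOne (x , iso , unique) = from f x , IsolatedRel-from f iso ,
    λ y iso′ → trans (sym (from∘to f y)) (cong (from f) (unique _ (IsolatedRel-from (≃-sym f) iso′)))

abstract
  profile₁ : All (λ t → Full t × components t ≡ 1) obstructions₁
  profile₁ = from-does (All.all? (λ t → full? t ×-dec components t ℕₚ.≟ 1) obstructions₁) refl

  -- Families 1 and 3 are told apart from this one by the number of components, families 4 and 5 by
  -- isolated vertices. The number itself is not constant here: 2P_3 + K_2 has three components, the
  -- other two graphs have two.
  profile₂ : All (λ t → Full t × components t ≢ 1 × components t ≢ 4 × ¬ HasIsolatedᵗ t) obstructions₂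
  profile₂ = from-does
    (All.all? (λ t → full? t ×-dec ¬? (components t ℕₚ.≟ 1) ×-dec ¬? (components t ℕₚ.≟ 4)
                       ×-dec ¬? (hasIsolated? t))
      obstructions₂) refl

  profile₃ : All (λ t → Full t × components t ≡ 4 × HasIsolatedᵗ t) obstructions₃
  profile₃ = from-does
    (All.all? (λ t → full? t ×-dec components t ℕₚ.≟ 4 ×-dec hasIsolated? t)
      obstructions₃) refl

  profile₄ : All (λ t → Full t × components t ≡ 3 × HasIsolatedᵗ t) obstructions₄
  profile₄ = from-does
    (All.all? (λ t → full? t ×-dec components t ℕₚ.≟ 3 ×-dec hasIsolated? t)
      obstructions₄) refl

  profile₅ : All (λ t → Full t × components t ≡ 2 × ExactlyOneIsolatedᵗ t) obstructions₅
  profile₅ = from-does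
    (All.all? (λ t → full? t ×-dec components t ℕₚ.≟ 2 ×-dec exactlyOneIsolated? t)
      obstructions₅) refl

-- Telling the five families apart

module _ (G : Graph) where

  Listed⇔ : Listed G ⇔ RepresentedBy obstructions G
  Listed⇔ = mk⇔ fwd bwd
    where
    fwd : Listed G → RepresentedBy obstructions G
    fwd (inj₁ x) = ++⁺ˡ (⇒ (Fam1⇔ G) x)
    fwd (inj₂ (inj₁ x)) = ++⁺ʳ obstructions₁ (++⁺ˡ (⇒ (Fam2⇔ G) x))
    fwd (inj₂ (inj₂ (inj₁ x))) = ++⁺ʳ obstructions₁ (++⁺ʳ obstructions₂ (++⁺ˡ (⇒ (Fam3⇔ G) x)))
    fwd (inj₂ (inj₂ (inj₂ (inj₁ x)))) =
      ++⁺ʳ obstructions₁ (++⁺ʳ obstructions₂ (++⁺ʳ obstructions₃ (++⁺ˡ (⇒ (Fam4⇔ G) x))))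
    fwd (inj₂ (inj₂ (inj₂ (inj₂ x)))) =
      ++⁺ʳ obstructions₁ (++⁺ʳ obstructions₂ (++⁺ʳ obstructions₃ (++⁺ʳ obstructions₄ (⇒ (Fam5⇔ G) x))))
    bwd : RepresentedBy obstructions G → Listed G
    bwd = Sum.map (⇐ (Fam1⇔ G)) (Sum.map (⇐ (Fam2⇔ G)) (Sum.map (⇐ (Fam3⇔ G))
            (Sum.map (⇐ (Fam4⇔ G)) (⇐ (Fam5⇔ G)) ∘ ++⁻ obstructions₄) ∘ ++⁻ obstructions₃)
            ∘ ++⁻ obstructions₂) ∘ ++⁻ obstructions₁

  minObs⇔Listed : CographMinObs ∞ (fin 2) G ⇔ Listed G
  minObs⇔Listed = mk⇔ (⇐ Listed⇔ ∘ minObs⇒represented G) (represented⇒minObs G ∘ ⇒ Listed⇔)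

  inspect : ∀ {Q : Cotree → Set} {ts} → All (λ t → Full t × Q t) ts → RepresentedBy ts G →
            ∃ λ t → Represents t G × Components G (components t) × Q t
  inspect q i with t , t∈ , f ← find i with full , r ← All.lookup q t∈ =
    t , f , represented-components G t full f , r

  Fam1-profile : Fam1 G → Connected G
  Fam1-profile x =
    let t , f , c , e = inspect profile₁ (⇒ (Fam1⇔ G) x)
    in subst (Components G) e c

  Fam2-profile : Fam2 G → ¬ Connected G × ¬ Components G 4 × ¬ HasIsolated G
  Fam2-profile x =
    let t , f , c , ≢1 , ≢4 , ¬iso = inspect profile₂ (⇒ (Fam2⇔ G) x)
    in ≢1 ∘ Components-unique G c , ≢4 ∘ Components-unique G c , ¬iso ∘ isolated-represented {G} f

  Fam3-profile : Fam3 G → Components G 4 × HasIsolated G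
  Fam3-profile x =
    let t , f , c , e , iso = inspect profile₃ (⇒ (Fam3⇔ G) x)
    in subst (Components G) e c , represented-isolated {G} f iso

  Fam4-profile : Fam4 G → Components G 3 × HasIsolated G
  Fam4-profile x =
    let t , f , c , e , iso = inspect profile₄ (⇒ (Fam4⇔ G) x)
    in subst (Components G) e c , represented-isolated {G} f iso

  Fam5-profile : Fam5 G → Components G 2 × ExactlyOneIsolated G
  Fam5-profile x =
    let t , f , c , e , iso = inspect profile₅ (⇒ (Fam5⇔ G) x)
    in subst (Components G) e c , represented-exactlyOne {G} f iso

  conflict : ∀ {A : Set} {c d} → c ≢ d → Components G c → Components G d → A
  conflict c≢d C D = ⊥-elim (c≢d (Components-unique G C D))

  Fam1⇔complement : Fam1 G ⇔ (Σ Graph λ H → FamH H × (co G ≅ (P₃ +ᴳ H)))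
  Fam1⇔complement = mk⇔
    (λ { (H , h , e) → H , h , ≃⇒≅ {co G} {P₃ +ᴳ H}
           (≃-trans (co-cong {G} {co (P₃ +ᴳ H)} (≅⇒≃ {G} {co (P₃ +ᴳ H)} e)) (co-involutive (P₃ +ᴳ H))) })
    (λ { (H , h , e) → H , h , ≃⇒≅ {G} {co (P₃ +ᴳ H)}
           (≃-trans (≃-sym (co-involutive G)) (co-cong {co G} {P₃ +ᴳ H} (≅⇒≃ {co G} {P₃ +ᴳ H} e))) })

  module _ (listed : Listed G) where

    connected⇔ : Connected G ⇔ Fam1 G
    connected⇔ = mk⇔ (λ C → pick C listed) Fam1-profile
      where
      pick : Connected G → Listed G → Fam1 G
      pick C (inj₁ x) = x
      pick C (inj₂ (inj₁ x)) = ⊥-elim (proj₁ (Fam2-profile x) C)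
      pick C (inj₂ (inj₂ (inj₁ x))) = conflict (λ ()) C (proj₁ (Fam3-profile x))
      pick C (inj₂ (inj₂ (inj₂ (inj₁ x)))) = conflict (λ ()) C (proj₁ (Fam4-profile x))
      pick C (inj₂ (inj₂ (inj₂ (inj₂ x)))) = conflict (λ ()) C (proj₁ (Fam5-profile x))

    disconnected⇔ : (¬ Connected G × ¬ HasIsolated G) ⇔ Fam2 G
    disconnected⇔ = mk⇔ (λ C → pick C listed)
      (λ x → proj₁ (Fam2-profile x) , proj₂ (proj₂ (Fam2-profile x)))
      where
      pick : ¬ Connected G × ¬ HasIsolated G → Listed G → Fam2 G
      pick (¬C , ¬I) (inj₁ x) = ⊥-elim (¬C (Fam1-profile x))
      pick (¬C , ¬I) (inj₂ (inj₁ x)) = x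
      pick (¬C , ¬I) (inj₂ (inj₂ (inj₁ x))) = ⊥-elim (¬I (proj₂ (Fam3-profile x)))
      pick (¬C , ¬I) (inj₂ (inj₂ (inj₂ (inj₁ x)))) = ⊥-elim (¬I (proj₂ (Fam4-profile x)))
      pick (¬C , ¬I) (inj₂ (inj₂ (inj₂ (inj₂ x)))) =
        let _ , v , I , _ = Fam5-profile x in ⊥-elim (¬I (v , I))

    fourComponents⇔ : Components G 4 ⇔ Fam3 G
    fourComponents⇔ = mk⇔ (λ C → pick C listed) (proj₁ ∘ Fam3-profile)
      where
      pick : Components G 4 → Listed G → Fam3 G
      pick C (inj₁ x) = conflict (λ ()) C (Fam1-profile x)
      pick C (inj₂ (inj₁ x)) = ⊥-elim (proj₁ (proj₂ (Fam2-profile x)) C)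
      pick C (inj₂ (inj₂ (inj₁ x))) = x
      pick C (inj₂ (inj₂ (inj₂ (inj₁ x)))) = conflict (λ ()) C (proj₁ (Fam4-profile x))
      pick C (inj₂ (inj₂ (inj₂ (inj₂ x)))) = conflict (λ ()) C (proj₁ (Fam5-profile x))

    threeComponents⇔ : (Components G 3 × HasIsolated G) ⇔ Fam4 G
    threeComponents⇔ = mk⇔ (λ C → pick C listed) Fam4-profile
      where
      pick : Components G 3 × HasIsolated G → Listed G → Fam4 G
      pick (C , I) (inj₁ x) = conflict (λ ()) C (Fam1-profile x)
      pick (C , I) (inj₂ (inj₁ x)) = ⊥-elim (proj₂ (proj₂ (Fam2-profile x)) I)
      pick (C , I) (inj₂ (inj₂ (inj₁ x))) = conflict (λ ()) C (proj₁ (Fam3-profile x))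
      pick (C , I) (inj₂ (inj₂ (inj₂ (inj₁ x)))) = x
      pick (C , I) (inj₂ (inj₂ (inj₂ (inj₂ x)))) = conflict (λ ()) C (proj₁ (Fam5-profile x))

    twoComponents⇔ : (Components G 2 × ExactlyOneIsolated G) ⇔ Fam5 G
    twoComponents⇔ = mk⇔ (λ C → pick C listed) Fam5-profile
      where
      pick : Components G 2 × ExactlyOneIsolated G → Listed G → Fam5 G
      pick (C , I) (inj₁ x) = conflict (λ ()) C (Fam1-profile x)
      pick (C , (v , I , _)) (inj₂ (inj₁ x)) = ⊥-elim (proj₂ (proj₂ (Fam2-profile x)) (v , I))
      pick (C , I) (inj₂ (inj₂ (inj₁ x))) = conflict (λ ()) C (proj₁ (Fam3-profile x))
      pick (C , I) (inj₂ (inj₂ (inj₂ (inj₁ x)))) = conflict (λ ()) C (proj₁ (Fam4-profile x))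
      pick (C , I) (inj₂ (inj₂ (inj₂ (inj₂ x)))) = x

theorem10 : (∀ (G : Graph) → CographMinObs ∞ (fin 2) G →
    (Connected G ⇔ (Σ Graph λ H → FamH H × (co G ≅ (P₃ +ᴳ H))))
    × ((¬ Connected G × ¬ HasIsolated G) ⇔ Fam2 G)
    × (Components G 4 ⇔ Fam3 G)
    × ((Components G 3 × HasIsolated G) ⇔ Fam4 G)
    × ((Components G 2 × ExactlyOneIsolated G) ⇔ Fam5 G))
    × (∀ (G : Graph) → (CographMinObs ∞ (fin 2) G ⇔ Listed G))
theorem10 = (λ G minObs → let listed = ⇒ (minObs⇔Listed G) minObs in
    ⇔-trans (connected⇔ G listed) (Fam1⇔complement G)
    , disconnected⇔ G listed
    , fourComponents⇔ G listed
    , threeComponents⇔ G listed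
    , twoComponents⇔ G listed)
  , minObs⇔Listed
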